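{- Let $\mathcal{R}$ be a finite valuation ring with residue field of cardinality $q$ and with uniformizer of nilpotency degree $r$ (so $|\mathcal{R}|=q^r$), and let $\mathcal{R}^*$ denote its group of units. Let $G$ be a subgroup of $\mathcal{R}^*$, let $g,h\colon G\to\mathcal{R}^*$ be arbitrary functions, and define $f\colon G\times\mathcal{R}^*\to\mathcal{R}$ by $f(x,y)=g(x)(h(x)+y)$. Put $m=\mu(g)$. Then there is a constant $c>0$ depending only on $r$ such that for all sets $A\subset G$ and $B,C\subset\mathcal{R}^*$, \[|f(A,B)|\,|B+C|\ \ge\ c\min\left\{\frac{q^r|B|}{m},\ \frac{|A||B|^2|C|}{m^2q^{2r-1}}\right\}.\]
   Context: A finite valuation ring is a finite commutative ring with identity that is local (has a unique maximal ideal) and principal (every ideal is principal); its maximal ideal is generated by a non-unit $z$ (a uniformizer), the residue field $\mathcal{R}/(z)$ has $q$ elements, and $r$ is the least integer with $z^r=0$. For a function $\varphi\colon G\to\mathcal{R}$, $\mu(\varphi)=\max_{t\in\mathcal{R}}|\{x\in G:\varphi(x)=t\}|$. Notation: $f(A,B)=\{f(x,y):x\in A,y\in B\}$ and $B+C=\{b+c:b\in B,c\in C\}$. -}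

module Defs where

open import Algebra.Bundles using (CommutativeRing)
import Algebra.Definitions as AlgebraDefinitions
import Algebra.Properties.AbelianGroup as AbelianGroupProperties
import Algebra.Properties.Ring as RingProperties
import Algebra.Properties.Semiring.Divisibility as Divisibility
import Algebra.Properties.Semiring.Exp as Exp
open import Data.Fin.Base using (Fin)
open import Data.Fin.Properties using (any?)
import Data.Fin.Properties as Fin
open import Data.Fin.Subset using (Subset; ⊤; ∣_∣) renaming (_∈_ to _∈ₛ_; _⊆_ to _⊆ₛ_)
open import Data.Fin.Subset.Properties using (p⊆q⇒∣p∣≤∣q∣; ∣⁅x⁆∣≡1; x∈⁅y⁆⇒x≡y)
  renaming (_∈?_ to _∈ₛ?_)
open import Data.List.Base using (map; allFin)
open import Data.List.Extrema.Nat using (max; v≤max⁺)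
open import Data.List.Membership.Propositional.Properties using (∈-allFin; ∈-map⁺)
import Data.List.Relation.Unary.Any as Any
open import Data.Nat.Base as ℕ using (ℕ; _<_; NonZero)
import Data.Nat.Properties as ℕ
open import Data.Product using (∃!)
open import Data.Product.Base using (Σ; ∃; _×_; _,_; proj₁; proj₂)
open import Data.Product.Relation.Binary.Pointwise.NonDependent using (_×ₛ_)
open import Data.Sum.Base using (_⊎_; inj₂)
open import Data.Vec.Base using (tabulate)
open import Data.Vec.Properties using (lookup⇒[]=; lookup∘tabulate)
open import Data.Vec.Properties.WithK using ([]=-irrelevant)
open import Function.Bundles using (Func; Inverse; _⇔_)
open import Level using (Level; _⊔_; suc)
open import Relation.Binary.Bundles using (Setoid)
import Relation.Binary.Construct.On as On
open import Relation.Binary.Definitions using (_Respects_)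
import Relation.Binary.Reasoning.Setoid as SetoidReasoning
open import Relation.Binary.PropositionalEquality as ≡ using (_≡_; _≢_)
open import Relation.Nullary.Decidable using (Dec; yes; no; does; map′; dec-true; _×-dec_)
open import Relation.Nullary.Negation.Core using (¬_)
open import Relation.Unary using (Pred; Decidable)

record FiniteCommutativeRing (a ℓ : Level) : Set (suc (a ⊔ ℓ)) where
  field
    commutativeRing : CommutativeRing a ℓ

  open CommutativeRing commutativeRing public

  field
    size        : ℕ
    enumeration : Inverse setoid (≡.setoid (Fin size))

  open Inverse enumeration public
    renaming (to to index; from to element; to-cong to index-cong; from-cong to element-cong)
    using (strictlyInverseˡ; strictlyInverseʳ)

-- Subsets of R are given by their sets of indices, as stdlib finite subsets.
-- These are exactly the decidable subsets of R closed under _≈_, which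
-- classically are all subsets.

module Subsets {a ℓ} (R : FiniteCommutativeRing a ℓ) where
  open FiniteCommutativeRing R
  open AlgebraDefinitions _≈_ using (Invertible)
  open Exp semiring using (_^_)
  open Divisibility semiring using (_∣_; _,_; ∣ʳ-respʳ-≈; _∣0)

  infix 4 _∈_ _∈?_ _≟_

  _∈_ : Carrier → Subset size → Set
  x ∈ S = index x ∈ₛ S

  _∈?_ : ∀ x (S : Subset size) → Dec (x ∈ S)
  x ∈? S = index x ∈ₛ? S

  ∈-resp-≈ : ∀ (S : Subset size) → (_∈ S) Respects _≈_
  ∈-resp-≈ S x≈y = ≡.subst (_∈ₛ S) (index-cong x≈y)

  index-injective : ∀ {x y} → index x ≡ index y → x ≈ y
  index-injective {x} {y} eq =
    trans (sym (strictlyInverseʳ x)) (trans (element-cong eq) (strictlyInverseʳ y))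

  _≟_ : ∀ x y → Dec (x ≈ y)
  x ≟ y = map′ index-injective index-cong (index x Fin.≟ index y)

  ∃? : ∀ {p} {P : Pred Carrier p} → P Respects _≈_ → Decidable P → Dec (∃ P)
  ∃? resp P? = map′
    (λ (i , p) → element i , p)
    (λ (x , p) → index x , resp (sym (strictlyInverseʳ x)) p)
    (any? (λ i → P? (element i)))

  -- { x | P x }; meaningful when P respects _≈_, since P is only tested on the
  -- representatives picked by the enumeration.
  ⟨_⟩ : ∀ {p} {P : Pred Carrier p} → Decidable P → Subset size
  ⟨ P? ⟩ = tabulate (λ i → does (P? (element i)))

  ∈-⟨⟩⁺ : ∀ {p} {P : Pred Carrier p} (P? : Decidable P) → P Respects _≈_ →
          ∀ {x} → P x → x ∈ ⟨ P? ⟩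
  ∈-⟨⟩⁺ P? resp {x} px = lookup⇒[]= (index x) _
    (≡.trans (lookup∘tabulate _ (index x))
             (dec-true (P? _) (resp (sym (strictlyInverseʳ x)) px)))

  ⟦_⟧ : Subset size → Setoid a ℓ
  ⟦ S ⟧ = On.setoid setoid (proj₁ {B = _∈ S})

  inclusion : ∀ S → Func ⟦ S ⟧ setoid
  inclusion S = record { to = proj₁ ; cong = λ x≈y → x≈y }

  Σ∈? : ∀ {p} (S : Subset size) {P : Pred (Setoid.Carrier ⟦ S ⟧) p} → Decidable P →
        Decidable (λ x → Σ (x ∈ S) λ x∈S → P (x , x∈S))
  Σ∈? S {P} P? x with x ∈? S
  ... | no  x∉S = no (λ (x∈S , _) → x∉S x∈S)
  ... | yes x∈S = map′
    (x∈S ,_)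
    (λ (x∈S′ , p) → ≡.subst (λ m → P (x , m)) ([]=-irrelevant x∈S′ x∈S) p)
    (P? (x , x∈S))

  ∃∈? : ∀ {p} (S : Subset size) {P : Pred (Setoid.Carrier ⟦ S ⟧) p} →
        P Respects (Setoid._≈_ ⟦ S ⟧) → Decidable P → Dec (∃ P)
  ∃∈? S resp P? = map′
    (λ (x , x∈S , p) → (x , x∈S) , p)
    (λ ((x , x∈S) , p) → x , x∈S , p)
    (∃? (λ x≈y (x∈S , p) → ∈-resp-≈ S x≈y x∈S , resp x≈y p) (Σ∈? S P?))

  IsUnit : Pred Carrier (a ⊔ ℓ)
  IsUnit = Invertible 1# _*_

  isUnit? : Decidable IsUnit
  isUnit? x = ∃?
    (λ y≈z (yx≈1 , xy≈1) → trans (*-congʳ (sym y≈z)) yx≈1 , trans (*-congˡ (sym y≈z)) xy≈1)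
    (λ y → (y * x ≟ 1#) ×-dec (x * y ≟ 1#))

  R* : Subset size
  R* = ⟨ isUnit? ⟩

  record IsSubgroupOfUnits (G : Subset size) : Set (a ⊔ ℓ) where
    field
      ⊆-units   : G ⊆ₛ R*
      1∈        : 1# ∈ G
      *-closed  : ∀ {x y} → x ∈ G → y ∈ G → x * y ∈ G
      ⁻¹-closed : ∀ {x y} → x ∈ G → x * y ≈ 1# → y ∈ G

  record IsIdeal (I : Subset size) : Set a where
    field
      0∈       : 0# ∈ I
      +-closed : ∀ {x y} → x ∈ I → y ∈ I → x + y ∈ I
      absorbs  : ∀ {x} y → x ∈ I → y * x ∈ I

  record IsMaximalIdeal (M : Subset size) : Set a where
    field
      isIdeal : IsIdeal M
      proper  : M ≢ ⊤
      maximal : ∀ {J} → IsIdeal J → M ⊆ₛ J → J ≡ M ⊎ J ≡ ⊤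

  IsGeneratedBy : Subset size → Carrier → Set (a ⊔ ℓ)
  IsGeneratedBy I z = ∀ x → x ∈ I ⇔ z ∣ x

  IsPrincipal : Subset size → Set (a ⊔ ℓ)
  IsPrincipal I = ∃ λ z → IsGeneratedBy I z

  IsNilpotencyDegree : Carrier → ℕ → Set ℓ
  IsNilpotencyDegree z r = z ^ r ≈ 0# × (∀ {k} → k < r → ¬ z ^ k ≈ 0#)

  -- R/(z): the elements of R up to congruence modulo z.
  quotient : Carrier → Setoid a (a ⊔ ℓ)
  quotient z = record
    { Carrier       = Carrier
    ; _≈_           = λ x y → z ∣ x - y
    ; isEquivalence = record
      { refl  = λ {x} → ∣ʳ-respʳ-≈ (sym (-‿inverseʳ x)) (z ∣0)
      ; sym   = λ {x} {y} (c , cz≈x-y) → - c , (begin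
          - c * z      ≈⟨ -‿distribˡ-* c z ⟨
          - (c * z)    ≈⟨ -‿cong cz≈x-y ⟩
          - (x - y)    ≈⟨ ⁻¹-anti-homo‿- x y ⟩
          y - x        ∎)
      ; trans = λ {x} {y} {w} (c , cz≈x-y) (d , dz≈y-w) → c + d , (begin
          (c + d) * z            ≈⟨ distribʳ z c d ⟩
          c * z + d * z          ≈⟨ +-cong cz≈x-y dz≈y-w ⟩
          (x - y) + (y - w)      ≈⟨ +-assoc x (- y) (y - w) ⟩
          x + (- y + (y - w))    ≈⟨ +-congˡ (+-assoc (- y) y (- w)) ⟨
          x + ((- y + y) - w)    ≈⟨ +-congˡ (+-congʳ (-‿inverseˡ y)) ⟩
          x + (0# - w)           ≈⟨ +-congˡ (+-identityˡ (- w)) ⟩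
          x - w                  ∎)
      }
    }
    where
    open SetoidReasoning setoid
    open RingProperties ring using (-‿distribˡ-*)
    open AbelianGroupProperties +-abelianGroup using (⁻¹-anti-homo‿-)

  quotientSize≢0 : ∀ {z q} → Inverse (quotient z) (≡.setoid (Fin q)) → NonZero q
  quotientSize≢0 e = Fin.nonZeroIndex (Inverse.to e 0#)

  InFibre : ∀ (G : Subset size) → Func ⟦ G ⟧ setoid → Carrier → Pred Carrier ℓ
  InFibre G φ t x = Σ (x ∈ G) λ x∈G → Func.to φ (x , x∈G) ≈ t

  inFibre? : ∀ G φ t → Decidable (InFibre G φ t)
  inFibre? G φ t = Σ∈? G (λ x → Func.to φ x ≟ t)

  fibre : ∀ (G : Subset size) → Func ⟦ G ⟧ setoid → Carrier → Subset size
  fibre G φ t = ⟨ inFibre? G φ t ⟩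

  μ : ∀ (G : Subset size) → Func ⟦ G ⟧ setoid → ℕ
  μ G φ = max 0 (map (λ i → ∣ fibre G φ (element i) ∣) (allFin size))

  μ≢0 : ∀ {G} → IsSubgroupOfUnits G → ∀ φ → NonZero (μ G φ)
  μ≢0 {G} isSubgroup φ = ℕ.>-nonZero (v≤max⁺ 0 _ (inj₂
    (Any.map (λ { ≡.refl → 1≤∣fibre∣ }) (∈-map⁺ _ (∈-allFin (index t))))))
    where
    1∈G = IsSubgroupOfUnits.1∈ isSubgroup
    t   = Func.to φ (1# , 1∈G)

    1∈fibre : 1# ∈ fibre G φ (element (index t))
    1∈fibre = ∈-⟨⟩⁺ (inFibre? G φ _)
      (λ x≈y (x∈G , eq) → ∈-resp-≈ G x≈y x∈G , trans (Func.cong φ (sym x≈y)) eq)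
      (1∈G , sym (strictlyInverseʳ t))

    1≤∣fibre∣ : 1 ℕ.≤ ∣ fibre G φ (element (index t)) ∣
    1≤∣fibre∣ = ℕ.≤-trans
      (ℕ.≤-reflexive (≡.sym (∣⁅x⁆∣≡1 (index 1#))))
      (p⊆q⇒∣p∣≤∣q∣ λ i∈ → ≡.subst (_∈ₛ _) (≡.sym (x∈⁅y⁆⇒x≡y _ i∈)) 1∈fibre)

  InImage : ∀ (S T : Subset size) → Func (⟦ S ⟧ ×ₛ ⟦ T ⟧) setoid →
            (A B : Subset size) → Pred Carrier (a ⊔ ℓ)
  InImage S T φ A B t =
    ∃ λ (x : Setoid.Carrier ⟦ S ⟧) → proj₁ x ∈ A ×
    ∃ λ (y : Setoid.Carrier ⟦ T ⟧) → proj₁ y ∈ B × Func.to φ (x , y) ≈ t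

  inImage? : ∀ S T φ A B → Decidable (InImage S T φ A B)
  inImage? S T φ A B t =
    ∃∈? S
      (λ x≈x′ (x∈A , y , y∈B , eq) →
        ∈-resp-≈ A x≈x′ x∈A , y , y∈B , trans (Func.cong φ (sym x≈x′ , refl)) eq)
      λ x → (proj₁ x ∈? A) ×-dec
    ∃∈? T
      (λ y≈y′ (y∈B , eq) →
        ∈-resp-≈ B y≈y′ y∈B , trans (Func.cong φ (refl , sym y≈y′)) eq)
      λ y → (proj₁ y ∈? B) ×-dec (Func.to φ (x , y) ≟ t)

  image : ∀ (S T : Subset size) → Func (⟦ S ⟧ ×ₛ ⟦ T ⟧) setoid →
          (A B : Subset size) → Subset size
  image S T φ A B = ⟨ inImage? S T φ A B ⟩

  InSumset : (B C : Subset size) → Pred Carrier (a ⊔ ℓ)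
  InSumset B C t = ∃ λ b → b ∈ B × ∃ λ c → c ∈ C × b + c ≈ t

  inSumset? : ∀ B C → Decidable (InSumset B C)
  inSumset? B C t =
    ∃? (λ b≈b′ (b∈B , c , c∈C , eq) →
         ∈-resp-≈ B b≈b′ b∈B , c , c∈C , trans (+-congʳ (sym b≈b′)) eq)
      λ b → (b ∈? B) ×-dec
    ∃? (λ c≈c′ (c∈C , eq) → ∈-resp-≈ C c≈c′ c∈C , trans (+-congˡ (sym c≈c′)) eq)
      λ c → (c ∈? C) ×-dec (b + c ≟ t)

  infixl 6 _⊕_

  _⊕_ : (B C : Subset size) → Subset size
  B ⊕ C = ⟨ inSumset? B C ⟩

  -- (x , y) ↦ g(x)(h(x) + y)
  affineTwist : ∀ {G} (g h : Func ⟦ G ⟧ ⟦ R* ⟧) → Func (⟦ G ⟧ ×ₛ ⟦ R* ⟧) setoid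
  affineTwist g h = record
    { to   = λ (x , y) → proj₁ (Func.to g x) * (proj₁ (Func.to h x) + proj₁ y)
    ; cong = λ (x≈x′ , y≈y′) → *-cong (Func.cong g x≈x′) (+-cong (Func.cong h x≈x′) y≈y′)
    }

record FiniteValuationRing (a ℓ : Level) : Set (suc (a ⊔ ℓ)) where
  field
    finiteCommutativeRing : FiniteCommutativeRing a ℓ

  open FiniteCommutativeRing finiteCommutativeRing public
  open Subsets finiteCommutativeRing public

  field
    local     : ∃! _≡_ IsMaximalIdeal
    principal : ∀ {I} → IsIdeal I → IsPrincipal I

  𝔪 : Subset size
  𝔪 = proj₁ local

  IsUniformizer : Carrier → Set (a ⊔ ℓ)
  IsUniformizer = IsGeneratedBy 𝔪

-- Each (x , c) ∈ A × C gives the line u = g(x)(h(x) + (s − c)) in R², which contains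
-- the |B| points (f(x , b) , b + c) of the grid f(A , B) × (B + C). Let N(u , s) be
-- the number of these lines through (u , s); its mean over R² is |A||C| / |R|. Lines
-- whose slopes differ modulo z meet at most once, and at most m|(z)| = mqʳ⁻¹ elements
-- x have a slope congruent to a given one, so the variance sum of N is at most
-- m|A||C|q²ʳ⁻¹. By Cauchy–Schwarz a grid with fewer than qʳ|B| / 2 points, on which N
-- sums to at least |A||B||C|, must have at least |A||B|²|C| / (4mq²ʳ⁻¹) points.

module Submission where

open import Defs
import Algebra.Properties.AbelianGroup as AbelianGroupProperties
import Algebra.Properties.CommutativeSemiring.Exp as Exp
import Algebra.Properties.Ring as RingProperties
import Algebra.Properties.Semiring.Divisibility as Divisibility
import Algebra.Properties.Semiring.Sum as SemiringSum
import Algebra.Solver.Ring.NaturalCoefficients.Default as SemiringSolver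
open import Data.Bool.Base using (true; false; if_then_else_)
open import Data.Fin.Base using (Fin; zero; suc)
open import Data.Fin.Permutation using (Permutation; permutation)
import Data.Fin.Properties as Fin
open import Data.Fin.Subset using (Subset; ∣_∣; _⊆_) renaming (_∈_ to _∈ₛ_)
open import Data.Fin.Subset.Properties using (∈⊤) renaming (_∈?_ to _∈ₛ?_)
open import Data.Integer.Base as ℤ using (+_)
import Data.Integer.Properties as ℤ
open import Data.List.Extrema.Nat using (v≤max⁺)
open import Data.List.Membership.Propositional.Properties using (∈-allFin; ∈-map⁺)
import Data.List.Relation.Unary.Any as Any
open import Data.Nat.Base using (ℕ; zero; suc; NonZero; _+_; _*_; _^_; _∸_; _≤_; _<_; z≤n; s≤s)
open import Data.Nat.Properties using (m*n≢0; m^n≢0)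
import Data.Nat.Properties as ℕ
open import Data.Nat.Tactic.RingSolver using (solve-∀)
open import Data.Product.Base using (∃; ∃-syntax; _×_; _,_; proj₁; proj₂)
open import Data.Rational.Base as ℚ using (0ℚ; _/_; _⊓_)
import Data.Rational.Properties as ℚ
open import Data.Rational.Unnormalised.Base as ℚᵘ using (mkℚᵘ)
import Data.Rational.Unnormalised.Properties as ℚᵘ
open import Data.Sum.Base as Sum using (_⊎_; inj₁; inj₂)
open import Data.Vec.Base using ([]; _∷_)
open import Data.Vec.Properties using ([]=⇒lookup; lookup∘tabulate)
open import Function.Base using (_∘_; it)
open import Function.Bundles using (Func; Inverse; Equivalence)
open import Function.Construct.Composition using (function)
open import Level using (Level)
open import Relation.Binary.Bundles using (Setoid)
open import Relation.Binary.Definitions using (_Respects_)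
open import Relation.Binary.PropositionalEquality as ≡
  using (_≡_; refl; cong; cong₂; sym; trans; subst; subst₂)
import Relation.Binary.Reasoning.Setoid as SetoidReasoning
open import Relation.Nullary.Decidable using (Dec; yes; no; does; map′)
open import Relation.Nullary.Negation using (¬_; contradiction)
open import Relation.Unary using (Pred; Decidable)

open SemiringSum ℕ.+-*-semiring using (sum; sum-syntax; sum-cong-≗; ∑-comm; ∑-distrib-+;
  *-distribˡ-sum; *-distribʳ-sum; ∑-permute)

private variable
  p q : Level
  P : Set p
  Q : Set q
  n k l : ℕ

∑-mono : {f g : Fin n → ℕ} → (∀ i → f i ≤ g i) → sum f ≤ sum g
∑-mono {zero}  f≤g = z≤n
∑-mono {suc n} f≤g = ℕ.+-mono-≤ (f≤g zero) (∑-mono (f≤g ∘ suc))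

∑-const : ∀ n x → ∑[ i < n ] x ≡ n * x
∑-const zero    x = refl
∑-const (suc n) x = cong (λ y → x + y) (∑-const n x)

sum*sum : (f : Fin n → ℕ) (g : Fin k → ℕ) → sum f * sum g ≡ ∑[ i < n ] ∑[ j < k ] (f i * g j)
sum*sum f g = trans (*-distribʳ-sum (sum g) f) (sum-cong-≗ λ i → *-distribˡ-sum (f i) g)

𝟙 : Dec P → ℕ
𝟙 P? = if does P? then 1 else 0

𝟙-yes : (P? : Dec P) → P → 𝟙 P? ≡ 1
𝟙-yes (yes _) _ = refl
𝟙-yes (no ¬p) p = contradiction p ¬p

𝟙-no : (P? : Dec P) → ¬ P → 𝟙 P? ≡ 0
𝟙-no (yes p) ¬p = contradiction p ¬p
𝟙-no (no _)  _  = refl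

𝟙≤1 : (P? : Dec P) → 𝟙 P? ≤ 1
𝟙≤1 (yes _) = ℕ.≤-refl
𝟙≤1 (no _)  = z≤n

𝟙-mono : (P? : Dec P) (Q? : Dec Q) → (P → Q) → 𝟙 P? ≤ 𝟙 Q?
𝟙-mono (yes p) Q? f = ℕ.≤-reflexive (sym (𝟙-yes Q? (f p)))
𝟙-mono (no _)  Q? f = z≤n

𝟙-cong : (P? : Dec P) (Q? : Dec Q) → (P → Q) → (Q → P) → 𝟙 P? ≡ 𝟙 Q?
𝟙-cong P? Q? f g = ℕ.≤-antisym (𝟙-mono P? Q? f) (𝟙-mono Q? P? g)

𝟙-idem : (P? : Dec P) → 𝟙 P? * 𝟙 P? ≡ 𝟙 P?
𝟙-idem (yes _) = refl
𝟙-idem (no _)  = refl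

𝟙*-monoʳ : (P? : Dec P) {m n : ℕ} → (P → m ≤ n) → 𝟙 P? * m ≤ 𝟙 P? * n
𝟙*-monoʳ (yes p) m≤n = ℕ.*-monoʳ-≤ 1 (m≤n p)
𝟙*-monoʳ (no _)  m≤n = z≤n

∑-𝟙-unique : {P : Fin n → Set p} (P? : ∀ i → Dec (P i)) →
             (∀ {i j} → P i → P j → i ≡ j) → ∑[ i < n ] 𝟙 (P? i) ≤ 1
∑-𝟙-unique {zero}  P? unique = z≤n
∑-𝟙-unique {suc n} P? unique with P? zero
... | yes p = s≤s (ℕ.≤-trans
  (∑-mono λ i → ℕ.≤-reflexive (𝟙-no (P? (suc i)) λ pᵢ → contradiction (unique p pᵢ) λ ()))
  (ℕ.≤-reflexive (trans (∑-const n 0) (ℕ.*-zeroʳ n))))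
... | no _  = ∑-𝟙-unique (P? ∘ suc) λ pᵢ pⱼ → Fin.suc-injective (unique pᵢ pⱼ)

∑-single≤ : (f : Fin n → ℕ) (i : Fin n) → f i ≤ sum f
∑-single≤ f zero    = ℕ.m≤m+n _ _
∑-single≤ f (suc i) = ℕ.≤-trans (∑-single≤ (f ∘ suc) i) (ℕ.m≤n+m _ _)

∑-𝟙-∃! : {P : Fin n → Set p} (P? : ∀ i → Dec (P i)) {i : Fin n} → P i →
         (∀ {i j} → P i → P j → i ≡ j) → ∑[ i < n ] 𝟙 (P? i) ≡ 1
∑-𝟙-∃! P? {i} pᵢ unique = ℕ.≤-antisym (∑-𝟙-unique P? unique)
  (ℕ.≤-trans (ℕ.≤-reflexive (sym (𝟙-yes (P? i) pᵢ))) (∑-single≤ (λ j → 𝟙 (P? j)) i))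

∑-𝟙-∃!-⇔ : {P : Fin n → Set p} (P? : ∀ i → Dec (P i)) (Q? : Dec Q) →
           (Q → ∃ P) → (∀ {i} → P i → Q) →
           (∀ {i j} → P i → P j → i ≡ j) → ∑[ i < n ] 𝟙 (P? i) ≡ 𝟙 Q?
∑-𝟙-∃!-⇔ P? (yes q) exists sound unique = ∑-𝟙-∃! P? (proj₂ (exists q)) unique
∑-𝟙-∃!-⇔ {n = n} P? (no ¬q) exists sound unique = trans
  (sum-cong-≗ λ i → 𝟙-no (P? i) (¬q ∘ sound)) (trans (∑-const n 0) (ℕ.*-zeroʳ n))

𝟙-≟-subst : (f : Fin n → ℕ) (i j : Fin n) → 𝟙 (i Fin.≟ j) * f j ≡ 𝟙 (i Fin.≟ j) * f i
𝟙-≟-subst f i j with i Fin.≟ j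
... | yes refl = refl
... | no  _    = refl

∑-sift : (f : Fin n → ℕ) (i : Fin n) → ∑[ j < n ] (𝟙 (i Fin.≟ j) * f j) ≡ f i
∑-sift f i = trans (sum-cong-≗ (𝟙-≟-subst f i)) (trans
  (sym (*-distribʳ-sum (f i) (λ j → 𝟙 (i Fin.≟ j))))
  (trans (cong (_* f i) (∑-𝟙-∃! (i Fin.≟_) refl λ eq eq′ → trans (sym eq) eq′)) (ℕ.*-identityˡ (f i))))

∣∣≡∑𝟙 : (S : Subset n) → ∣ S ∣ ≡ ∑[ i < n ] 𝟙 (i ∈ₛ? S)
∣∣≡∑𝟙 []          = refl
∣∣≡∑𝟙 (true  ∷ S) = cong suc (∣∣≡∑𝟙 S)
∣∣≡∑𝟙 (false ∷ S) = ∣∣≡∑𝟙 S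

∑² : (Fin n → Fin k → ℕ) → ℕ
∑² {n} {k} f = ∑[ i < n ] ∑[ j < k ] f i j

∑²-cong : {f g : Fin n → Fin k → ℕ} → (∀ i j → f i j ≡ g i j) → ∑² f ≡ ∑² g
∑²-cong f≡g = sum-cong-≗ λ i → sum-cong-≗ (f≡g i)

∑²-mono : {f g : Fin n → Fin k → ℕ} → (∀ i j → f i j ≤ g i j) → ∑² f ≤ ∑² g
∑²-mono f≤g = ∑-mono λ i → ∑-mono (f≤g i)

∑²-const : ∀ n k x → ∑² {n} {k} (λ _ _ → x) ≡ n * (k * x)
∑²-const n k x = trans (sum-cong-≗ {n} λ _ → ∑-const k x) (∑-const n (k * x))

∑²-distrib-+ : (f g : Fin n → Fin k → ℕ) → ∑² (λ i j → f i j + g i j) ≡ ∑² f + ∑² g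
∑²-distrib-+ f g = trans (sum-cong-≗ λ i → ∑-distrib-+ (f i) (g i))
  (∑-distrib-+ (λ i → sum (f i)) (λ i → sum (g i)))

*-distribˡ-∑² : ∀ x (f : Fin n → Fin k → ℕ) → x * ∑² f ≡ ∑² (λ i j → x * f i j)
*-distribˡ-∑² x f = trans (*-distribˡ-sum x (λ i → sum (f i))) (sum-cong-≗ λ i → *-distribˡ-sum x (f i))

2xy≤x²+y² : ∀ x y → 2 * (x * y) ≤ x * x + y * y
2xy≤x²+y² x y with ℕ.≤-total x y
... | inj₁ x≤y with d , refl ← ℕ.m≤n⇒∃[o]m+o≡n x≤y =
  ℕ.≤-trans (ℕ.m≤m+n _ (d * d)) (ℕ.≤-reflexive (expand x d))
  where
  expand : ∀ x d → 2 * (x * (x + d)) + d * d ≡ x * x + (x + d) * (x + d)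
  expand = solve-∀
... | inj₂ y≤x with d , refl ← ℕ.m≤n⇒∃[o]m+o≡n y≤x =
  ℕ.≤-trans (ℕ.m≤m+n _ (d * d)) (ℕ.≤-reflexive (expand y d))
  where
  expand : ∀ y d → 2 * ((y + d) * y) + d * d ≡ (y + d) * (y + d) + y * y
  expand = solve-∀

-- Cauchy–Schwarz applied to the deviation of N from its mean K / n on the set
-- with indicator χ. To avoid subtraction, 2xy ≤ x² + y² is summed instead, with
-- x = bnN and y = bK + γχ; the choice γ = 2n²T balances the two error terms.
deviation-bound : .{{NonZero n}} → (N χ : Fin n → Fin n → ℕ) → (∀ u s → χ u s * χ u s ≡ χ u s) →
  ∀ K b T .{{_ : NonZero T}} →
  ∑² N ≡ n * K →
  ∑² (λ u s → N u s * N u s) ≤ K * K + K * (n * T) →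
  K * b ≤ ∑² (λ u s → χ u s * N u s) →
  2 * ∑² χ ≤ n * b →
  K * (b * b) ≤ 4 * ∑² χ * (n * T)
deviation-bound {n} N χ χ²≡χ K b T mean second rich few =
  ℕ.*-cancelʳ-≤ _ _ (n * n * n * T) (ℕ.+-cancelˡ-≤ (2 * E + 3 * X) _ _ (begin
    (2 * E + 3 * X) + K * (b * b) * (n * n * n * T)
      ≡⟨ split n K b T ⟩
    (2 * (b * n) * (b * K)) * (n * K) + (2 * (b * n) * γ) * (K * b)
      ≤⟨ ℕ.+-monoʳ-≤ _ (ℕ.*-monoʳ-≤ (2 * (b * n) * γ) rich) ⟩
    (2 * (b * n) * (b * K)) * (n * K) + (2 * (b * n) * γ) * ∑² χN
      ≤⟨ summed ⟩
    (b * n * (b * n)) * ∑² NN + n * (n * (b * K * (b * K))) + (2 * (b * K) * γ + γ * γ) * ∑² χ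
      ≤⟨ ℕ.+-monoˡ-≤ _ (ℕ.+-monoˡ-≤ _ (ℕ.*-monoʳ-≤ (b * n * (b * n)) second)) ⟩
    (b * n * (b * n)) * (K * K + K * (n * T)) + n * (n * (b * K * (b * K))) + (2 * (b * K) * γ + γ * γ) * ∑² χ
      ≡⟨ regroup n K b T (∑² χ) ⟩
    (2 * E + X + γ * γ * ∑² χ) + b * K * γ * (2 * ∑² χ)
      ≤⟨ ℕ.+-monoʳ-≤ _ (ℕ.*-monoʳ-≤ (b * K * γ) few) ⟩
    (2 * E + X + γ * γ * ∑² χ) + b * K * γ * (n * b)
      ≡⟨ balance n K b T (∑² χ) ⟩
    (2 * E + 3 * X) + 4 * ∑² χ * (n * T) * (n * n * n * T) ∎))
  where
  open ℕ.≤-Reasoning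
  χN NN : Fin n → Fin n → ℕ
  χN u s = χ u s * N u s
  NN u s = N u s * N u s
  γ E X : ℕ
  γ = 2 * n * n * T
  E = b * n * (b * n) * (K * K)
  X = K * (b * b) * (n * n * n * T)
  instance
    n³T≢0 : NonZero (n * n * n * T)
    n³T≢0 = ℕ.m*n≢0 (n * n * n) T {{ℕ.m*n≢0 (n * n) n {{ℕ.m*n≢0 n n}}}}

  split : ∀ n K b T →
    (2 * (b * n * (b * n) * (K * K)) + 3 * (K * (b * b) * (n * n * n * T))) + K * (b * b) * (n * n * n * T) ≡
    (2 * (b * n) * (b * K)) * (n * K) + (2 * (b * n) * (2 * n * n * T)) * (K * b)
  split = solve-∀

  regroup : ∀ n K b T P →
    (b * n * (b * n)) * (K * K + K * (n * T)) + n * (n * (b * K * (b * K))) +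
      (2 * (b * K) * (2 * n * n * T) + 2 * n * n * T * (2 * n * n * T)) * P ≡
    (2 * (b * n * (b * n) * (K * K)) + K * (b * b) * (n * n * n * T) + 2 * n * n * T * (2 * n * n * T) * P) +
      b * K * (2 * n * n * T) * (2 * P)
  regroup = solve-∀

  balance : ∀ n K b T P →
    (2 * (b * n * (b * n) * (K * K)) + K * (b * b) * (n * n * n * T) + 2 * n * n * T * (2 * n * n * T) * P) +
      b * K * (2 * n * n * T) * (n * b) ≡
    (2 * (b * n * (b * n) * (K * K)) + 3 * (K * (b * b) * (n * n * n * T))) + 4 * P * (n * T) * (n * n * n * T)
  balance = solve-∀

  pointwise : ∀ α β γ v x → x * x ≡ x →
    (2 * α * β) * v + (2 * α * γ) * (x * v) ≤ (α * α) * (v * v) + β * β + (2 * β * γ + γ * γ) * x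
  pointwise α β γ v x x²≡x = begin
    (2 * α * β) * v + (2 * α * γ) * (x * v)                      ≡⟨ lhs α β γ v x ⟩
    2 * (α * v * (β + γ * x))                                    ≤⟨ 2xy≤x²+y² (α * v) (β + γ * x) ⟩
    α * v * (α * v) + (β + γ * x) * (β + γ * x)                  ≡⟨ rhs α β γ v x ⟩
    (α * α) * (v * v) + β * β + (2 * β * γ * x + γ * γ * (x * x))
      ≡⟨ cong (λ y → (α * α) * (v * v) + β * β + (2 * β * γ * x + γ * γ * y)) x²≡x ⟩
    (α * α) * (v * v) + β * β + (2 * β * γ * x + γ * γ * x)
      ≡⟨ cong (λ y → (α * α) * (v * v) + β * β + y) (ℕ.*-distribʳ-+ x (2 * β * γ) (γ * γ)) ⟨
    (α * α) * (v * v) + β * β + (2 * β * γ + γ * γ) * x          ∎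
    where
    lhs : ∀ α β γ v x → (2 * α * β) * v + (2 * α * γ) * (x * v) ≡ 2 * (α * v * (β + γ * x))
    lhs = solve-∀
    rhs : ∀ α β γ v x → α * v * (α * v) + (β + γ * x) * (β + γ * x) ≡
      (α * α) * (v * v) + β * β + (2 * β * γ * x + γ * γ * (x * x))
    rhs = solve-∀

  summed : (2 * (b * n) * (b * K)) * (n * K) + (2 * (b * n) * γ) * ∑² χN ≤
    (b * n * (b * n)) * ∑² NN + n * (n * (b * K * (b * K))) + (2 * (b * K) * γ + γ * γ) * ∑² χ
  summed = begin
    c₁ * (n * K) + c₂ * ∑² χN
      ≡⟨ cong (λ y → c₁ * y + c₂ * ∑² χN) mean ⟨
    c₁ * ∑² N + c₂ * ∑² χN
      ≡⟨ cong₂ _+_ (*-distribˡ-∑² c₁ N) (*-distribˡ-∑² c₂ χN) ⟩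
    ∑² (λ u s → c₁ * N u s) + ∑² (λ u s → c₂ * χN u s)
      ≡⟨ ∑²-distrib-+ (λ u s → c₁ * N u s) (λ u s → c₂ * χN u s) ⟨
    ∑² (λ u s → c₁ * N u s + c₂ * χN u s)
      ≤⟨ ∑²-mono (λ u s → pointwise (b * n) (b * K) γ (N u s) (χ u s) (χ²≡χ u s)) ⟩
    ∑² (λ u s → c₃ * NN u s + c₄ + c₅ * χ u s)
      ≡⟨ ∑²-distrib-+ (λ u s → c₃ * NN u s + c₄) (λ u s → c₅ * χ u s) ⟩
    ∑² (λ u s → c₃ * NN u s + c₄) + ∑² (λ u s → c₅ * χ u s)
      ≡⟨ cong₂ _+_ (∑²-distrib-+ (λ u s → c₃ * NN u s) (λ _ _ → c₄)) (sym (*-distribˡ-∑² c₅ χ)) ⟩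
    ∑² (λ u s → c₃ * NN u s) + ∑² {n} {n} (λ _ _ → c₄) + c₅ * ∑² χ
      ≡⟨ cong (_+ c₅ * ∑² χ) (cong₂ _+_ (sym (*-distribˡ-∑² c₃ NN)) (∑²-const n n c₄)) ⟩
    c₃ * ∑² NN + n * (n * c₄) + c₅ * ∑² χ ∎
    where
    c₁ c₂ c₃ c₄ c₅ : ℕ
    c₁ = 2 * (b * n) * (b * K)
    c₂ = 2 * (b * n) * γ
    c₃ = b * n * (b * n)
    c₄ = b * K * (b * K)
    c₅ = 2 * (b * K) * γ + γ * γ

*-swap : ∀ x y z → x * (y * z) ≡ y * (x * z)
*-swap = solve-∀

*-rotate : ∀ x y z → x * (y * z) ≡ z * (x * y)
*-rotate = solve-∀

∑²-* : (h : Fin n → Fin k → ℕ) (w : Fin l → ℕ) (f : Fin l → Fin n → Fin k → ℕ) →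
  ∑² (λ u s → h u s * ∑[ x < l ] (w x * f x u s)) ≡ ∑[ x < l ] (w x * ∑² (λ u s → h u s * f x u s))
∑²-* {n} {k} {l} h w f = begin
  ∑² (λ u s → h u s * ∑[ x < l ] (w x * f x u s))
    ≡⟨ ∑²-cong (λ u s → *-distribˡ-sum (h u s) (λ x → w x * f x u s)) ⟩
  ∑² (λ u s → ∑[ x < l ] (h u s * (w x * f x u s)))
    ≡⟨ sum-cong-≗ (λ u → ∑-comm (λ s x → h u s * (w x * f x u s))) ⟩
  ∑² (λ u x → ∑[ s < k ] (h u s * (w x * f x u s)))
    ≡⟨ ∑-comm (λ u x → ∑[ s < k ] (h u s * (w x * f x u s))) ⟩
  ∑[ x < l ] ∑² (λ u s → h u s * (w x * f x u s))
    ≡⟨ sum-cong-≗ (λ x → ∑²-cong λ u s → *-swap (h u s) (w x) (f x u s)) ⟩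
  ∑[ x < l ] ∑² (λ u s → w x * (h u s * f x u s))
    ≡⟨ sum-cong-≗ (λ x → *-distribˡ-∑² (w x) (λ u s → h u s * f x u s)) ⟨
  ∑[ x < l ] (w x * ∑² (λ u s → h u s * f x u s)) ∎
  where open ≡.≡-Reasoning

∑²-graph : (w : Fin n → Fin k → ℕ) (f : Fin k → Fin n) →
  ∑² (λ u s → w u s * 𝟙 (f s Fin.≟ u)) ≡ ∑[ s < k ] w (f s) s
∑²-graph {n} {k} w f = trans (∑-comm (λ u s → w u s * 𝟙 (f s Fin.≟ u)))
  (sum-cong-≗ λ s → trans (sum-cong-≗ λ u → ℕ.*-comm (w u s) (𝟙 (f s Fin.≟ u))) (∑-sift (λ u → w u s) (f s)))

-- line x c s is the first coordinate of the point of the line (x , c) whose second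
-- coordinate is s; the lines of A × C are counted on the grid F × S.
module _ {n} (A C F S : Subset n) (line : Fin n → Fin n → Fin n → Fin n) where

  private
    linesAt : Fin n → Fin n → Fin n → ℕ
    linesAt x u s = ∑[ c < n ] (𝟙 (c ∈ₛ? C) * 𝟙 (line x c s Fin.≟ u))

    N χ : Fin n → Fin n → ℕ
    N u s = ∑[ x < n ] (𝟙 (x ∈ₛ? A) * linesAt x u s)
    χ u s = 𝟙 (u ∈ₛ? F) * 𝟙 (s ∈ₛ? S)

    ∑-∈ : ∀ (B : Subset n) k → ∑[ x < n ] (𝟙 (x ∈ₛ? B) * k) ≡ ∣ B ∣ * k
    ∑-∈ B k = trans (sym (*-distribʳ-sum k (λ x → 𝟙 (x ∈ₛ? B)))) (cong (_* k) (sym (∣∣≡∑𝟙 B)))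

    ∑²-χ : ∑² χ ≡ ∣ F ∣ * ∣ S ∣
    ∑²-χ = trans (sym (sum*sum (λ u → 𝟙 (u ∈ₛ? F)) (λ s → 𝟙 (s ∈ₛ? S))))
                 (sym (cong₂ _*_ (∣∣≡∑𝟙 F) (∣∣≡∑𝟙 S)))

    χ-idem : ∀ u s → χ u s * χ u s ≡ χ u s
    χ-idem u s = trans (swap (𝟙 (u ∈ₛ? F)) (𝟙 (s ∈ₛ? S))) (cong₂ _*_ (𝟙-idem (u ∈ₛ? F)) (𝟙-idem (s ∈ₛ? S)))
      where
      swap : ∀ x y → x * y * (x * y) ≡ x * x * (y * y)
      swap = solve-∀

    ∑²-*N : (h : Fin n → Fin n → ℕ) → ∑² (λ u s → h u s * N u s) ≡
      ∑[ x < n ] (𝟙 (x ∈ₛ? A) * ∑² (λ u s → h u s * linesAt x u s))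
    ∑²-*N h = ∑²-* h (λ x → 𝟙 (x ∈ₛ? A)) linesAt

    ∑²-*linesAt : (h : Fin n → Fin n → ℕ) (x : Fin n) → ∑² (λ u s → h u s * linesAt x u s) ≡
      ∑[ c < n ] (𝟙 (c ∈ₛ? C) * ∑[ s < n ] h (line x c s) s)
    ∑²-*linesAt h x = trans
      (∑²-* h (λ c → 𝟙 (c ∈ₛ? C)) (λ c u s → 𝟙 (line x c s Fin.≟ u)))
      (sum-cong-≗ λ c → cong (𝟙 (c ∈ₛ? C) *_) (∑²-graph h (line x c)))

    ∑²-1*linesAt : ∀ x → ∑² (λ u s → 1 * linesAt x u s) ≡ ∣ C ∣ * n
    ∑²-1*linesAt x = begin
      ∑² (λ u s → 1 * linesAt x u s)
        ≡⟨ ∑²-*linesAt (λ _ _ → 1) x ⟩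
      ∑[ c < n ] (𝟙 (c ∈ₛ? C) * ∑[ s < n ] 1)
        ≡⟨ ∑-∈ C (∑[ s < n ] 1) ⟩
      ∣ C ∣ * ∑[ s < n ] 1
        ≡⟨ cong (∣ C ∣ *_) (trans (∑-const n 1) (ℕ.*-identityʳ n)) ⟩
      ∣ C ∣ * n ∎
      where open ≡.≡-Reasoning

    ∑²-N : ∑² N ≡ n * (∣ A ∣ * ∣ C ∣)
    ∑²-N = begin
      ∑² N
        ≡⟨ ∑²-cong (λ u s → ℕ.*-identityˡ (N u s)) ⟨
      ∑² (λ u s → 1 * N u s)
        ≡⟨ ∑²-*N (λ _ _ → 1) ⟩
      ∑[ x < n ] (𝟙 (x ∈ₛ? A) * ∑² (λ u s → 1 * linesAt x u s))
        ≡⟨ sum-cong-≗ (λ x → cong (𝟙 (x ∈ₛ? A) *_) (∑²-1*linesAt x)) ⟩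
      ∑[ x < n ] (𝟙 (x ∈ₛ? A) * (∣ C ∣ * n))
        ≡⟨ ∑-∈ A (∣ C ∣ * n) ⟩
      ∣ A ∣ * (∣ C ∣ * n)
        ≡⟨ *-rotate (∣ A ∣) (∣ C ∣) n ⟩
      n * (∣ A ∣ * ∣ C ∣) ∎
      where open ≡.≡-Reasoning

  incidence-bound : .{{NonZero n}} → ∀ {p} {Near : Fin n → Fin n → Set p}
    (Near? : ∀ x x′ → Dec (Near x x′)) (b T : ℕ) .{{_ : NonZero T}} →
    (∀ {x s c c′} → line x c s ≡ line x c′ s → c ≡ c′) →
    (∀ {x x′ c c′ s t} → ¬ Near x x′ →
      line x c s ≡ line x′ c′ s → line x c t ≡ line x′ c′ t → s ≡ t) →
    (∀ x → ∑[ x′ < n ] (𝟙 (x′ ∈ₛ? A) * 𝟙 (Near? x x′)) ≤ T) →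
    (∀ {x c} → x ∈ₛ A → c ∈ₛ C → b ≤ ∑[ s < n ] χ (line x c s) s) →
    2 * (∣ F ∣ * ∣ S ∣) ≤ n * b →
    ∣ A ∣ * ∣ C ∣ * (b * b) ≤ 4 * (∣ F ∣ * ∣ S ∣) * (n * T)
  incidence-bound {Near = Near} Near? b T parallel meet near rich few =
    subst (λ P → ∣ A ∣ * ∣ C ∣ * (b * b) ≤ 4 * P * (n * T)) ∑²-χ
      (deviation-bound N χ χ-idem (∣ A ∣ * ∣ C ∣) b T ∑²-N second incident
        (subst (λ P → 2 * P ≤ n * b) (sym ∑²-χ) few))
    where
    open ℕ.≤-Reasoning

    incident : ∣ A ∣ * ∣ C ∣ * b ≤ ∑² (λ u s → χ u s * N u s)
    incident = begin
      ∣ A ∣ * ∣ C ∣ * b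
        ≡⟨ ℕ.*-assoc (∣ A ∣) (∣ C ∣) b ⟩
      ∣ A ∣ * (∣ C ∣ * b)
        ≡⟨ trans (sum-cong-≗ (λ x → cong (𝟙 (x ∈ₛ? A) *_) (∑-∈ C b))) (∑-∈ A (∣ C ∣ * b)) ⟨
      ∑[ x < n ] (𝟙 (x ∈ₛ? A) * ∑[ c < n ] (𝟙 (c ∈ₛ? C) * b))
        ≤⟨ ∑-mono (λ x → 𝟙*-monoʳ (x ∈ₛ? A) λ x∈A → ∑-mono λ c → 𝟙*-monoʳ (c ∈ₛ? C) (rich x∈A)) ⟩
      ∑[ x < n ] (𝟙 (x ∈ₛ? A) * ∑[ c < n ] (𝟙 (c ∈ₛ? C) * ∑[ s < n ] χ (line x c s) s))
        ≡⟨ sum-cong-≗ (λ x → cong (𝟙 (x ∈ₛ? A) *_) (∑²-*linesAt χ x)) ⟨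
      ∑[ x < n ] (𝟙 (x ∈ₛ? A) * ∑² (λ u s → χ u s * linesAt x u s))
        ≡⟨ ∑²-*N χ ⟨
      ∑² (λ u s → χ u s * N u s) ∎

    linesAt≤1 : ∀ x u s → linesAt x u s ≤ 1
    linesAt≤1 x u s = ℕ.≤-trans
      (∑-mono λ c → ℕ.≤-trans (ℕ.*-monoˡ-≤ (𝟙 (line x c s Fin.≟ u)) (𝟙≤1 (c ∈ₛ? C)))
                              (ℕ.≤-reflexive (ℕ.*-identityˡ (𝟙 (line x c s Fin.≟ u)))))
      (∑-𝟙-unique (λ c → line x c s Fin.≟ u) λ eq eq′ → parallel (trans eq (sym eq′)))

    meetings : Fin n → Fin n → ℕ
    meetings x x′ = ∑² (λ u s → linesAt x u s * linesAt x′ u s)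

    meetings≤near : ∀ x x′ → meetings x x′ ≤ ∣ C ∣ * n
    meetings≤near x x′ = ℕ.≤-trans
      (∑²-mono λ u s → ℕ.*-monoˡ-≤ (linesAt x′ u s) (linesAt≤1 x u s))
      (ℕ.≤-reflexive (∑²-1*linesAt x′))

    meetings≤far : ∀ {x x′} → ¬ Near x x′ → meetings x x′ ≤ ∣ C ∣ * ∣ C ∣
    meetings≤far {x} {x′} ¬near = begin
      meetings x x′
        ≡⟨ ∑²-*linesAt (linesAt x) x′ ⟩
      ∑[ c′ < n ] (𝟙 (c′ ∈ₛ? C) * ∑[ s < n ] linesAt x (line x′ c′ s) s)
        ≤⟨ ∑-mono (λ c′ → ℕ.*-monoʳ-≤ (𝟙 (c′ ∈ₛ? C)) (atMostOnce c′)) ⟩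
      ∑[ c′ < n ] (𝟙 (c′ ∈ₛ? C) * ∣ C ∣)
        ≡⟨ ∑-∈ C ∣ C ∣ ⟩
      ∣ C ∣ * ∣ C ∣ ∎
      where
      atMostOnce : ∀ c′ → ∑[ s < n ] linesAt x (line x′ c′ s) s ≤ ∣ C ∣
      atMostOnce c′ = begin
        ∑[ s < n ] ∑[ c < n ] (𝟙 (c ∈ₛ? C) * 𝟙 (line x c s Fin.≟ line x′ c′ s))
          ≡⟨ ∑-comm (λ s c → 𝟙 (c ∈ₛ? C) * 𝟙 (line x c s Fin.≟ line x′ c′ s)) ⟩
        ∑[ c < n ] ∑[ s < n ] (𝟙 (c ∈ₛ? C) * 𝟙 (line x c s Fin.≟ line x′ c′ s))
          ≡⟨ sum-cong-≗ (λ c → *-distribˡ-sum (𝟙 (c ∈ₛ? C)) (λ s → 𝟙 (line x c s Fin.≟ line x′ c′ s))) ⟨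
        ∑[ c < n ] (𝟙 (c ∈ₛ? C) * ∑[ s < n ] 𝟙 (line x c s Fin.≟ line x′ c′ s))
          ≤⟨ ∑-mono (λ c → ℕ.*-monoʳ-≤ (𝟙 (c ∈ₛ? C))
               (∑-𝟙-unique (λ s → line x c s Fin.≟ line x′ c′ s) (meet ¬near))) ⟩
        ∑[ c < n ] (𝟙 (c ∈ₛ? C) * 1)
          ≡⟨ trans (∑-∈ C 1) (ℕ.*-identityʳ ∣ C ∣) ⟩
        ∣ C ∣ ∎

    meetings≤ : ∀ x x′ → meetings x x′ ≤ ∣ C ∣ * ∣ C ∣ + 𝟙 (Near? x x′) * (∣ C ∣ * n)
    meetings≤ x x′ with Near? x x′
    ... | yes _    = ℕ.≤-trans (meetings≤near x x′)
      (ℕ.≤-trans (ℕ.≤-reflexive (sym (ℕ.*-identityˡ _))) (ℕ.m≤n+m _ (∣ C ∣ * ∣ C ∣)))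
    ... | no ¬near = ℕ.≤-trans (meetings≤far ¬near) (ℕ.m≤m+n _ _)

    row : ∀ x → ∑² (λ u s → N u s * linesAt x u s) ≤ ∣ A ∣ * (∣ C ∣ * ∣ C ∣) + T * (∣ C ∣ * n)
    row x = begin
      ∑² (λ u s → N u s * linesAt x u s)
        ≡⟨ ∑²-cong (λ u s → ℕ.*-comm (N u s) (linesAt x u s)) ⟩
      ∑² (λ u s → linesAt x u s * N u s)
        ≡⟨ ∑²-*N (linesAt x) ⟩
      ∑[ x′ < n ] (𝟙 (x′ ∈ₛ? A) * meetings x x′)
        ≤⟨ ∑-mono (λ x′ → ℕ.*-monoʳ-≤ (𝟙 (x′ ∈ₛ? A)) (meetings≤ x x′)) ⟩
      ∑[ x′ < n ] (𝟙 (x′ ∈ₛ? A) * (∣ C ∣ * ∣ C ∣ + 𝟙 (Near? x x′) * (∣ C ∣ * n)))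
        ≡⟨ sum-cong-≗ (λ x′ → expand (𝟙 (x′ ∈ₛ? A)) (∣ C ∣ * ∣ C ∣) (𝟙 (Near? x x′)) (∣ C ∣ * n)) ⟩
      ∑[ x′ < n ] (𝟙 (x′ ∈ₛ? A) * (∣ C ∣ * ∣ C ∣) + 𝟙 (x′ ∈ₛ? A) * 𝟙 (Near? x x′) * (∣ C ∣ * n))
        ≡⟨ ∑-distrib-+ (λ x′ → 𝟙 (x′ ∈ₛ? A) * (∣ C ∣ * ∣ C ∣))
             (λ x′ → 𝟙 (x′ ∈ₛ? A) * 𝟙 (Near? x x′) * (∣ C ∣ * n)) ⟩
      ∑[ x′ < n ] (𝟙 (x′ ∈ₛ? A) * (∣ C ∣ * ∣ C ∣)) + ∑[ x′ < n ] (𝟙 (x′ ∈ₛ? A) * 𝟙 (Near? x x′) * (∣ C ∣ * n))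
        ≡⟨ cong₂ _+_ (∑-∈ A (∣ C ∣ * ∣ C ∣))
             (sym (*-distribʳ-sum (∣ C ∣ * n) (λ x′ → 𝟙 (x′ ∈ₛ? A) * 𝟙 (Near? x x′)))) ⟩
      ∣ A ∣ * (∣ C ∣ * ∣ C ∣) + ∑[ x′ < n ] (𝟙 (x′ ∈ₛ? A) * 𝟙 (Near? x x′)) * (∣ C ∣ * n)
        ≤⟨ ℕ.+-monoʳ-≤ (∣ A ∣ * (∣ C ∣ * ∣ C ∣)) (ℕ.*-monoˡ-≤ (∣ C ∣ * n) (near x)) ⟩
      ∣ A ∣ * (∣ C ∣ * ∣ C ∣) + T * (∣ C ∣ * n) ∎
      where
      expand : ∀ a x y z → a * (x + y * z) ≡ a * x + a * y * z
      expand = solve-∀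

    second : ∑² (λ u s → N u s * N u s) ≤ ∣ A ∣ * ∣ C ∣ * (∣ A ∣ * ∣ C ∣) + ∣ A ∣ * ∣ C ∣ * (n * T)
    second = begin
      ∑² (λ u s → N u s * N u s)
        ≡⟨ ∑²-*N N ⟩
      ∑[ x < n ] (𝟙 (x ∈ₛ? A) * ∑² (λ u s → N u s * linesAt x u s))
        ≤⟨ ∑-mono (λ x → ℕ.*-monoʳ-≤ (𝟙 (x ∈ₛ? A)) (row x)) ⟩
      ∑[ x < n ] (𝟙 (x ∈ₛ? A) * (∣ A ∣ * (∣ C ∣ * ∣ C ∣) + T * (∣ C ∣ * n)))
        ≡⟨ ∑-∈ A _ ⟩
      ∣ A ∣ * (∣ A ∣ * (∣ C ∣ * ∣ C ∣) + T * (∣ C ∣ * n))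
        ≡⟨ expand (∣ A ∣) (∣ C ∣) n T ⟩
      ∣ A ∣ * ∣ C ∣ * (∣ A ∣ * ∣ C ∣) + ∣ A ∣ * ∣ C ∣ * (n * T) ∎
      where
      expand : ∀ a c n T → a * (a * (c * c) + T * (c * n)) ≡ a * c * (a * c) + a * c * (n * T)
      expand = solve-∀

does-true : ∀ {p} {P : Set p} (P? : Dec P) → does P? ≡ true → P
does-true (yes p) refl = p

module _ {a ℓ} (R : FiniteValuationRing a ℓ) where
  open FiniteValuationRing R hiding (zero)
    renaming (_+_ to _+ᴿ_; _*_ to _·_; _-_ to _-ᴿ_; -_ to -ᴿ_; refl to ≈-refl; sym to ≈-sym; trans to ≈-trans)
  open Exp commutativeSemiring using (^-distrib-*) renaming (_^_ to _^ᴿ_)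
  open Divisibility semiring using (_∣_; _,_; _∣0; 0∣x⇒x≈0; ∣ʳ-respʳ-≈; ∣ʳ-respˡ-≈; ∣ʳ-trans; x∣ʳyx)
  open RingProperties ring using (-‿distribˡ-*; x[y-z]≈xy-xz; [y-z]x≈yx-zx)
  open AbelianGroupProperties +-abelianGroup using (//-rightDividesˡ; //-rightDividesʳ;
    inverseʳ-unique; x∙y⁻¹≈ε⇒x≈y; ∙-cancelˡ; ⁻¹-injective; ⁻¹-involutive)

  private
    module ≈-Reasoning = SetoidReasoning setoid
    module +-solver = SemiringSolver commutativeSemiring

  ∈-⟨⟩⁻ : ∀ {p} {P : Pred Carrier p} (P? : Decidable P) → P Respects _≈_ → ∀ {x} → x ∈ ⟨ P? ⟩ → P x
  ∈-⟨⟩⁻ P? resp {x} x∈ = resp (strictlyInverseʳ x) (does-true (P? (element (index x)))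
    (trans (sym (lookup∘tabulate _ (index x))) ([]=⇒lookup x∈)))

  infix 4 _∣?_

  _∣?_ : ∀ x y → Dec (x ∣ y)
  x ∣? y = map′ (λ (c , cx≈y) → c , cx≈y) (λ (c , cx≈y) → c , cx≈y)
    (∃? (λ c≈d cx≈y → ≈-trans (*-congʳ (≈-sym c≈d)) cx≈y) (λ c → c · x ≟ y))

  ∣-+ : ∀ {x y w} → x ∣ y → x ∣ w → x ∣ y +ᴿ w
  ∣-+ (c , cx≈y) (d , dx≈w) = c +ᴿ d , ≈-trans (distribʳ _ c d) (+-cong cx≈y dx≈w)

  unit-cancelˡ : ∀ {u x y} → IsUnit u → u · x ≈ u · y → x ≈ y
  unit-cancelˡ {u} {x} {y} (v , vu≈1 , _) ux≈uy = let open ≈-Reasoning in begin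
    x              ≈⟨ *-identityˡ x ⟨
    1# · x         ≈⟨ *-congʳ vu≈1 ⟨
    v · u · x      ≈⟨ *-assoc v u x ⟩
    v · (u · x)    ≈⟨ *-congˡ ux≈uy ⟩
    v · (u · y)    ≈⟨ *-assoc v u y ⟨
    v · u · y      ≈⟨ *-congʳ vu≈1 ⟩
    1# · y         ≈⟨ *-identityˡ y ⟩
    y              ∎

  ∑-translate : (f : Carrier → ℕ) → (∀ {x y} → x ≈ y → f x ≡ f y) → ∀ t →
    ∑[ i < size ] f (element i +ᴿ t) ≡ ∑[ i < size ] f (element i)
  ∑-translate f f-cong t = sym (trans (∑-permute (λ i → f (element i)) π)
    (sum-cong-≗ λ i → f-cong (strictlyInverseʳ (element i +ᴿ t))))
    where
    shift : Carrier → Fin size → Fin size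
    shift s i = index (element i +ᴿ s)

    shift-shift : ∀ s s′ → (∀ x → (x +ᴿ s′) +ᴿ s ≈ x) → ∀ i → shift s (shift s′ i) ≡ i
    shift-shift s s′ cancel i = trans
      (index-cong (≈-trans (+-congʳ (strictlyInverseʳ _)) (cancel (element i))))
      (strictlyInverseˡ i)

    π : Permutation size size
    π = permutation (shift t) (shift (-ᴿ t))
      (shift-shift t (-ᴿ t) (//-rightDividesˡ t)) (shift-shift (-ᴿ t) t (//-rightDividesʳ t))

  -- By maximality 𝔪 + (y) = R, so 1 + vy ∈ 𝔪 for some v; a power of this
  -- element vanishes and is also ≡ 1 modulo y.
  ∤⇒unit : ∀ {z} → IsUniformizer z → ∀ {r} → z ^ᴿ r ≈ 0# → ∀ {y} → ¬ z ∣ y → IsUnit y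
  ∤⇒unit {z} uniformizer {r} z^r≈0 {y} z∤y = -ᴿ t , -ty≈1 , ≈-trans (*-comm y (-ᴿ t)) -ty≈1
    where
    open IsMaximalIdeal (proj₁ (proj₂ local))
    open IsIdeal isIdeal

    InJ : Pred Carrier a
    InJ x = ∃ λ v → (x +ᴿ v · y) ∈ 𝔪

    inJ-resp : InJ Respects _≈_
    inJ-resp x≈x′ (v , x+vy∈𝔪) = v , ∈-resp-≈ 𝔪 (+-congʳ x≈x′) x+vy∈𝔪

    inJ? : Decidable InJ
    inJ? x = ∃? (λ v≈v′ → ∈-resp-≈ 𝔪 (+-congˡ (*-congʳ v≈v′))) (λ v → (x +ᴿ v · y) ∈? 𝔪)

    J : Subset size
    J = ⟨ inJ? ⟩

    ∈J⁺ : ∀ {x} v → (x +ᴿ v · y) ∈ 𝔪 → x ∈ J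
    ∈J⁺ v x+vy∈𝔪 = ∈-⟨⟩⁺ inJ? inJ-resp (v , x+vy∈𝔪)

    x∈𝔪⇒x∈J : ∀ {x} → x ∈ 𝔪 → x ∈ J
    x∈𝔪⇒x∈J {x} = ∈J⁺ 0# ∘ ∈-resp-≈ 𝔪 (≈-sym (≈-trans (+-congˡ (zeroˡ y)) (+-identityʳ x)))

    J-isIdeal : IsIdeal J
    J-isIdeal = record
      { 0∈       = x∈𝔪⇒x∈J 0∈
      ; +-closed = λ {x} {x′} x∈J x′∈J →
          let v  , x+vy∈𝔪   = ∈-⟨⟩⁻ inJ? inJ-resp x∈J
              v′ , x′+v′y∈𝔪 = ∈-⟨⟩⁻ inJ? inJ-resp x′∈J
          in ∈J⁺ (v +ᴿ v′) (∈-resp-≈ 𝔪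
               (solve 5 (λ x v x′ v′ y → (x :+ v :* y) :+ (x′ :+ v′ :* y) := (x :+ x′) :+ (v :+ v′) :* y)
                 ≈-refl x v x′ v′ y)
               (+-closed x+vy∈𝔪 x′+v′y∈𝔪))
      ; absorbs  = λ {x} w x∈J →
          let v , x+vy∈𝔪 = ∈-⟨⟩⁻ inJ? inJ-resp x∈J
          in ∈J⁺ (w · v) (∈-resp-≈ 𝔪
               (solve 4 (λ w x v y → w :* (x :+ v :* y) := w :* x :+ (w :* v) :* y) ≈-refl w x v y)
               (absorbs w x+vy∈𝔪))
      }
      where open +-solver

    y∈J : y ∈ J
    y∈J = ∈J⁺ (-ᴿ 1#) (∈-resp-≈ 𝔪 (≈-sym y-y≈0) 0∈)
      where
      y-y≈0 : y +ᴿ -ᴿ 1# · y ≈ 0#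
      y-y≈0 = ≈-trans (+-congˡ (≈-trans (≈-sym (-‿distribˡ-* 1# y)) (-‿cong (*-identityˡ y)))) (-‿inverseʳ y)

    1∈J : 1# ∈ J
    1∈J with maximal J-isIdeal (λ {i} i∈𝔪 → subst (_∈ₛ J) (strictlyInverseˡ i)
               (x∈𝔪⇒x∈J (subst (_∈ₛ 𝔪) (sym (strictlyInverseˡ i)) i∈𝔪)))
    ... | inj₁ J≡𝔪 = contradiction (Equivalence.to (uniformizer y) (subst (y ∈_) J≡𝔪 y∈J)) z∤y
    ... | inj₂ J≡⊤ = subst (1# ∈_) (sym J≡⊤) ∈⊤

    v : Carrier
    v = proj₁ (∈-⟨⟩⁻ inJ? inJ-resp 1∈J)

    z∣1+vy : z ∣ 1# +ᴿ v · y
    z∣1+vy = Equivalence.to (uniformizer _) (proj₂ (∈-⟨⟩⁻ inJ? inJ-resp 1∈J))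

    powers : ∀ k → ∃ λ t → (1# +ᴿ v · y) ^ᴿ k ≈ 1# +ᴿ t · y
    powers zero = 0# , ≈-sym (≈-trans (+-congˡ (zeroˡ y)) (+-identityʳ 1#))
    powers (suc k) with t , eq ← powers k = _ , ≈-trans (*-congˡ eq)
      (solve 3 (λ v t y → (con 1 :+ v :* y) :* (con 1 :+ t :* y) :=
        con 1 :+ (v :+ t :+ v :* y :* t) :* y) ≈-refl v t y)
      where open +-solver

    t : Carrier
    t = proj₁ (powers r)

    1+ty≈0 : 1# +ᴿ t · y ≈ 0#
    1+ty≈0 with w , wz≈1+vy ← z∣1+vy = let open ≈-Reasoning in begin
      1# +ᴿ t · y             ≈⟨ proj₂ (powers r) ⟨
      (1# +ᴿ v · y) ^ᴿ r      ≈⟨ Exp.^-congˡ commutativeSemiring r wz≈1+vy ⟨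
      (w · z) ^ᴿ r            ≈⟨ ^-distrib-* w z r ⟩
      w ^ᴿ r · z ^ᴿ r         ≈⟨ *-congˡ z^r≈0 ⟩
      w ^ᴿ r · 0#             ≈⟨ zeroʳ _ ⟩
      0#                      ∎

    -ty≈1 : -ᴿ t · y ≈ 1#
    -ty≈1 = let open ≈-Reasoning in begin
      -ᴿ t · y      ≈⟨ -‿distribˡ-* t y ⟨
      -ᴿ (t · y)    ≈⟨ -‿cong (inverseʳ-unique 1# (t · y) 1+ty≈0) ⟩
      -ᴿ (-ᴿ 1#)    ≈⟨ ⁻¹-involutive 1# ⟩
      1#            ∎

  multiples : Carrier → ℕ
  multiples x = ∑[ i < size ] 𝟙 (x ∣? element i)

  multiples-cong : ∀ {x y} → x ≈ y → multiples x ≡ multiples y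
  multiples-cong x≈y = sum-cong-≗ λ i →
    𝟙-cong (_ ∣? element i) (_ ∣? element i) (∣ʳ-respˡ-≈ x≈y) (∣ʳ-respˡ-≈ (≈-sym x≈y))

  multiples-antitone : ∀ {x y} → x ∣ y → multiples y ≤ multiples x
  multiples-antitone {x} {y} x∣y = ∑-mono λ i → 𝟙-mono (y ∣? element i) (x ∣? element i) (∣ʳ-trans x∣y)

  ∑-𝟙-∣-translate : ∀ x t → ∑[ i < size ] 𝟙 (x ∣? element i -ᴿ t) ≡ multiples x
  ∑-𝟙-∣-translate x t = ∑-translate (λ y → 𝟙 (x ∣? y))
    (λ y≈y′ → 𝟙-cong (x ∣? _) (x ∣? _) (∣ʳ-respʳ-≈ y≈y′) (∣ʳ-respʳ-≈ (≈-sym y≈y′))) (-ᴿ t)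

  multiples-1 : multiples 1# ≡ size
  multiples-1 = trans (sum-cong-≗ λ i → 𝟙-yes (1# ∣? element i) (element i , *-identityʳ _))
                      (trans (∑-const size 1) (ℕ.*-identityʳ size))

  multiples-0 : multiples 0# ≡ 1
  multiples-0 = ∑-𝟙-∃! (λ i → 0# ∣? element i) {index 0#} (∣ʳ-respʳ-≈ (≈-sym (strictlyInverseʳ 0#)) (0# ∣0))
    λ {i} {j} 0∣i 0∣j → trans (sym (strictlyInverseˡ i)) (trans
      (index-cong (≈-trans (0∣x⇒x≈0 0∣i) (≈-sym (0∣x⇒x≈0 0∣j)))) (strictlyInverseˡ j))

  module _ {z r q} (uniformizer : IsUniformizer z) (nilpotency : IsNilpotencyDegree z r)
           (residueField : Inverse (quotient z) (≡.setoid (Fin q))) where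

    unit : ∀ {y} → ¬ z ∣ y → IsUnit y
    unit = ∤⇒unit uniformizer {r} (proj₁ nilpotency)

    ^∣-cancelˡ : ∀ {i x y} → i < r → z ^ᴿ suc i ∣ z ^ᴿ i · x -ᴿ z ^ᴿ i · y → z ∣ x -ᴿ y
    ^∣-cancelˡ {i} {x} {y} i<r (w , wzⁱ⁺¹≈zⁱx-zⁱy) with z ∣? x -ᴿ y
    ... | yes z∣x-y = z∣x-y
    ... | no  z∤x-y = contradiction zⁱ≈0 (proj₂ nilpotency i<r)
      where
      e = x -ᴿ y

      e-wz-unit : IsUnit (e -ᴿ w · z)
      e-wz-unit = unit λ z∣e-wz → z∤x-y
        (∣ʳ-respʳ-≈ (//-rightDividesˡ (w · z) e) (∣-+ z∣e-wz (x∣ʳyx z w)))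

      zⁱ≈0 : z ^ᴿ i ≈ 0#
      zⁱ≈0 = unit-cancelˡ e-wz-unit (let open ≈-Reasoning in begin
        (e -ᴿ w · z) · z ^ᴿ i              ≈⟨ [y-z]x≈yx-zx (z ^ᴿ i) e (w · z) ⟩
        e · z ^ᴿ i -ᴿ w · z · z ^ᴿ i       ≈⟨ +-cong (*-comm e _) (-‿cong (*-assoc w z _)) ⟩
        z ^ᴿ i · e -ᴿ w · z ^ᴿ suc i       ≈⟨ +-congˡ (-‿cong (≈-trans wzⁱ⁺¹≈zⁱx-zⁱy (≈-sym (x[y-z]≈xy-xz _ x y)))) ⟩
        z ^ᴿ i · e -ᴿ z ^ᴿ i · e           ≈⟨ -‿inverseʳ _ ⟩
        0#                                 ≈⟨ zeroʳ _ ⟨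
        (e -ᴿ w · z) · 0#                  ∎)

    representative : Fin q → Carrier
    representative = Inverse.from residueField

    -- zⁱR is the disjoint union of the cosets zⁱρ + zⁱ⁺¹R, where ρ runs through
    -- representatives of the residue field.
    ∑-cosets : ∀ {i} → i < r → ∀ y →
      ∑[ d < q ] 𝟙 (z ^ᴿ suc i ∣? y -ᴿ z ^ᴿ i · representative d) ≡ 𝟙 (z ^ᴿ i ∣? y)
    ∑-cosets {i} i<r y = ∑-𝟙-∃!-⇔ (λ d → z ^ᴿ suc i ∣? y -ᴿ z ^ᴿ i · representative d)
      (z ^ᴿ i ∣? y) covered within unique
      where
      open Setoid (quotient z) using () renaming (sym to sym/z)
      module /zⁱ⁺¹ = Setoid (quotient (z ^ᴿ suc i))

      covered : z ^ᴿ i ∣ y → ∃ λ d → z ^ᴿ suc i ∣ y -ᴿ z ^ᴿ i · representative d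
      covered (w , wzⁱ≈y) with c , cz≈w-ρ ← sym/z (Inverse.strictlyInverseʳ residueField w) =
        Inverse.to residueField w , c , (let open ≈-Reasoning in begin
          c · z ^ᴿ suc i                                 ≈⟨ *-assoc c z _ ⟨
          c · z · z ^ᴿ i                                 ≈⟨ *-congʳ cz≈w-ρ ⟩
          (w -ᴿ ρ) · z ^ᴿ i                              ≈⟨ [y-z]x≈yx-zx _ w ρ ⟩
          w · z ^ᴿ i -ᴿ ρ · z ^ᴿ i                       ≈⟨ +-cong wzⁱ≈y (-‿cong (*-comm ρ _)) ⟩
          y -ᴿ z ^ᴿ i · ρ                                ∎)
        where ρ = representative (Inverse.to residueField w)

      within : ∀ {d} → z ^ᴿ suc i ∣ y -ᴿ z ^ᴿ i · representative d → z ^ᴿ i ∣ y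
      within {d} zⁱ⁺¹∣ = ∣ʳ-respʳ-≈ (//-rightDividesˡ _ y)
        (∣-+ (∣ʳ-trans (x∣ʳyx (z ^ᴿ i) z) zⁱ⁺¹∣) (representative d , *-comm _ _))

      unique : ∀ {d d′} → z ^ᴿ suc i ∣ y -ᴿ z ^ᴿ i · representative d →
               z ^ᴿ suc i ∣ y -ᴿ z ^ᴿ i · representative d′ → d ≡ d′
      unique {d} {d′} y≡d y≡d′ = trans (sym (Inverse.strictlyInverseˡ residueField d)) (trans
        (Inverse.to-cong residueField (^∣-cancelˡ i<r
          (/zⁱ⁺¹.trans {z ^ᴿ i · representative d} {y} {z ^ᴿ i · representative d′}
            (/zⁱ⁺¹.sym {y} {z ^ᴿ i · representative d} y≡d) y≡d′)))
        (Inverse.strictlyInverseˡ residueField d′))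

    multiples-^-suc : ∀ {i} → i < r → multiples (z ^ᴿ i) ≡ q * multiples (z ^ᴿ suc i)
    multiples-^-suc {i} i<r = trans (sum-cong-≗ λ y → sym (∑-cosets i<r (element y)))
      (trans (∑-comm (λ y d → 𝟙 (z ^ᴿ suc i ∣? element y -ᴿ z ^ᴿ i · representative d)))
        (trans (sum-cong-≗ λ d → ∑-𝟙-∣-translate (z ^ᴿ suc i) (z ^ᴿ i · representative d))
          (∑-const q _)))

    multiples-^ : ∀ i k → i + k ≡ r → multiples (z ^ᴿ i) ≡ q ^ k
    multiples-^ i zero    i≡r = trans (multiples-cong (≈-trans
      (Exp.^-congʳ commutativeSemiring z (trans (sym (ℕ.+-identityʳ i)) i≡r)) (proj₁ nilpotency))) multiples-0
    multiples-^ i (suc k) eq  = trans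
      (multiples-^-suc (ℕ.≤-trans (ℕ.m≤m+n (suc i) k) (ℕ.≤-reflexive (trans (sym (ℕ.+-suc i k)) eq))))
      (cong (q *_) (multiples-^ (suc i) k (trans (sym (ℕ.+-suc i k)) eq)))

    size≡q^r : size ≡ q ^ r
    size≡q^r = trans (sym multiples-1) (multiples-^ 0 r refl)

  multiples-uniformizer : ∀ {z r q} → IsUniformizer z → IsNilpotencyDegree z r →
    Inverse (quotient z) (≡.setoid (Fin q)) → multiples z ≤ q ^ (r ∸ 1)
  multiples-uniformizer {z} {zero}  {q} uniformizer nilpotency residueField =
    ℕ.≤-trans (multiples-antitone (z , *-identityʳ z))
      (ℕ.≤-reflexive (multiples-^ uniformizer nilpotency residueField 0 0 refl))
  multiples-uniformizer {z} {suc r} {q} uniformizer nilpotency residueField = ℕ.≤-reflexive (trans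
    (multiples-cong (≈-sym (*-identityʳ z)))
    (multiples-^ uniformizer nilpotency residueField 1 r refl))

  isUnit-resp : IsUnit Respects _≈_
  isUnit-resp x≈y (v , vx≈1 , xv≈1) =
    v , ≈-trans (*-congˡ (≈-sym x≈y)) vx≈1 , ≈-trans (*-congʳ (≈-sym x≈y)) xv≈1

  ∈R*⇒unit : ∀ {x} → x ∈ R* → IsUnit x
  ∈R*⇒unit = ∈-⟨⟩⁻ isUnit? isUnit-resp

  element-injective : ∀ {i j} → element i ≈ element j → i ≡ j
  element-injective {i} {j} eq =
    trans (sym (strictlyInverseˡ i)) (trans (index-cong eq) (strictlyInverseˡ j))

  element∈ : ∀ {S i} → i ∈ₛ S → element i ∈ S
  element∈ {S} {i} = subst (_∈ₛ S) (sym (strictlyInverseˡ i))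

  ∣fibre∣≤μ : ∀ G (φ : Func ⟦ G ⟧ setoid) i → ∣ fibre G φ (element i) ∣ ≤ μ G φ
  ∣fibre∣≤μ G φ i = v≤max⁺ 0 _ (inj₂ (Any.map ℕ.≤-reflexive
    (∈-map⁺ (λ j → ∣ fibre G φ (element j) ∣) (∈-allFin i))))

  module _ {G : Subset size} where

    extend : Func ⟦ G ⟧ ⟦ R* ⟧ → Carrier → Carrier
    extend φ x with x ∈? G
    ... | yes x∈G = proj₁ (Func.to φ (x , x∈G))
    ... | no  _   = 1#

    extend-∈ : ∀ φ {x} (x∈G : x ∈ G) → extend φ x ≈ proj₁ (Func.to φ (x , x∈G))
    extend-∈ φ {x} x∈G with x ∈? G
    ... | yes x∈G′ = Func.cong φ ≈-refl
    ... | no  x∉G  = contradiction x∈G x∉G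

    extend-unit : ∀ φ x → IsUnit (extend φ x)
    extend-unit φ x with x ∈? G
    ... | yes x∈G = ∈R*⇒unit (proj₂ (Func.to φ (x , x∈G)))
    ... | no  _   = 1# , *-identityˡ 1# , *-identityˡ 1#

    module _ (g h : Func ⟦ G ⟧ ⟦ R* ⟧) where

      slope : Fin size → Carrier
      slope x = extend g (element x)

      height : Fin size → Fin size → Carrier → Carrier
      height x c w = slope x · (extend h (element x) +ᴿ (w -ᴿ element c))

      height-cong : ∀ x c {w w′} → w ≈ w′ → height x c w ≈ height x c w′
      height-cong x c w≈w′ = *-congˡ (+-congˡ (+-congʳ w≈w′))

      -- The point (u , s) lies on the line of (x , c) iff u = g(x)(h(x) + (s − c)).
      line : Fin size → Fin size → Fin size → Fin size
      line x c s = index (height x c (element s))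

      line-parallel : ∀ {x s c c′} → line x c s ≡ line x c′ s → c ≡ c′
      line-parallel {x} eq = element-injective (⁻¹-injective (∙-cancelˡ _ _ _ (∙-cancelˡ _ _ _
        (unit-cancelˡ (extend-unit g (element x)) (index-injective eq)))))

      height-difference : ∀ x c s t → height x c s ≈ height x c t +ᴿ slope x · (s -ᴿ t)
      height-difference x c s t = ≈-trans (height-cong x c (≈-sym (//-rightDividesˡ t s)))
        (solve 5 (λ a b d t c → a :* (b :+ ((d :+ t) :+ c)) := a :* (b :+ (t :+ c)) :+ a :* d) ≈-refl
          (slope x) (extend h (element x)) (s -ᴿ t) t (-ᴿ element c))
        where open +-solver

      line-meet : ∀ {x x′ c c′ s t} → IsUnit (slope x′ -ᴿ slope x) →
        line x c s ≡ line x′ c′ s → line x c t ≡ line x′ c′ t → s ≡ t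
      line-meet {x} {x′} {c} {c′} {s} {t} unit eqₛ eqₜ = element-injective (x∙y⁻¹≈ε⇒x≈y _ _ d≈0)
        where
        d = element s -ᴿ element t

        slopes : slope x · d ≈ slope x′ · d
        slopes = ∙-cancelˡ (height x c (element t)) _ _ (let open ≈-Reasoning in begin
          height x c (element t) +ᴿ slope x · d       ≈⟨ height-difference x c _ _ ⟨
          height x c (element s)                      ≈⟨ index-injective eqₛ ⟩
          height x′ c′ (element s)                    ≈⟨ height-difference x′ c′ _ _ ⟩
          height x′ c′ (element t) +ᴿ slope x′ · d    ≈⟨ +-congʳ (index-injective eqₜ) ⟨
          height x c (element t) +ᴿ slope x′ · d      ∎)

        d≈0 : d ≈ 0#
        d≈0 = unit-cancelˡ unit (let open ≈-Reasoning in begin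
          (slope x′ -ᴿ slope x) · d      ≈⟨ [y-z]x≈yx-zx d (slope x′) (slope x) ⟩
          slope x′ · d -ᴿ slope x · d    ≈⟨ +-congˡ (-‿cong slopes) ⟩
          slope x′ · d -ᴿ slope x′ · d   ≈⟨ -‿inverseʳ _ ⟩
          0#                             ≈⟨ zeroʳ _ ⟨
          (slope x′ -ᴿ slope x) · 0#     ∎)

      ∑-near : ∀ {A} → A ⊆ G → ∀ z x →
        ∑[ x′ < size ] (𝟙 (x′ ∈ₛ? A) * 𝟙 (z ∣? slope x′ -ᴿ slope x)) ≤
        μ G (function g (inclusion R*)) * multiples z
      ∑-near {A} A⊆G z x = ℕ.≤-trans (ℕ.≤-reflexive byValue) (ℕ.≤-trans
        (∑-mono λ t → ℕ.*-monoʳ-≤ (𝟙 (near? t)) (valueBound t))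
        (ℕ.≤-reflexive (trans
          (sym (*-distribʳ-sum (μ G φ) (λ t → 𝟙 (near? t))))
          (trans (cong (_* μ G φ) (∑-𝟙-∣-translate z (slope x))) (ℕ.*-comm (multiples z) (μ G φ))))))
        where
        φ = function g (inclusion R*)

        near? : ∀ t → Dec (z ∣ element t -ᴿ slope x)
        near? t = z ∣? element t -ᴿ slope x

        value : Fin size → Fin size
        value x′ = index (slope x′)

        byValue : ∑[ x′ < size ] (𝟙 (x′ ∈ₛ? A) * 𝟙 (z ∣? slope x′ -ᴿ slope x)) ≡
          ∑[ t < size ] (𝟙 (near? t) * ∑[ x′ < size ] (𝟙 (value x′ Fin.≟ t) * 𝟙 (x′ ∈ₛ? A)))
        byValue = begin
          ∑[ x′ < size ] (𝟙 (x′ ∈ₛ? A) * 𝟙 (z ∣? slope x′ -ᴿ slope x))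
            ≡⟨ sum-cong-≗ (λ x′ → trans
                 (cong (𝟙 (x′ ∈ₛ? A) *_) (𝟙-cong (z ∣? slope x′ -ᴿ slope x) (near? (value x′))
                   (∣ʳ-respʳ-≈ (+-congʳ (≈-sym (strictlyInverseʳ (slope x′)))))
                   (∣ʳ-respʳ-≈ (+-congʳ (strictlyInverseʳ (slope x′))))))
                 (sym (∑-sift (λ t → 𝟙 (x′ ∈ₛ? A) * 𝟙 (near? t)) (value x′)))) ⟩
          ∑[ x′ < size ] ∑[ t < size ] (𝟙 (value x′ Fin.≟ t) * (𝟙 (x′ ∈ₛ? A) * 𝟙 (near? t)))
            ≡⟨ ∑-comm (λ x′ t → 𝟙 (value x′ Fin.≟ t) * (𝟙 (x′ ∈ₛ? A) * 𝟙 (near? t))) ⟩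
          ∑[ t < size ] ∑[ x′ < size ] (𝟙 (value x′ Fin.≟ t) * (𝟙 (x′ ∈ₛ? A) * 𝟙 (near? t)))
            ≡⟨ sum-cong-≗ (λ t → trans
                 (sum-cong-≗ λ x′ → *-rotate (𝟙 (value x′ Fin.≟ t)) (𝟙 (x′ ∈ₛ? A)) (𝟙 (near? t)))
                 (sym (*-distribˡ-sum (𝟙 (near? t)) (λ x′ → 𝟙 (value x′ Fin.≟ t) * 𝟙 (x′ ∈ₛ? A))))) ⟩
          ∑[ t < size ] (𝟙 (near? t) * ∑[ x′ < size ] (𝟙 (value x′ Fin.≟ t) * 𝟙 (x′ ∈ₛ? A))) ∎
          where open ≡.≡-Reasoning

        valueBound : ∀ t → ∑[ x′ < size ] (𝟙 (value x′ Fin.≟ t) * 𝟙 (x′ ∈ₛ? A)) ≤ μ G φ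
        valueBound t = ℕ.≤-trans (∑-mono λ x′ → pointwise x′)
          (ℕ.≤-trans (ℕ.≤-reflexive (sym (∣∣≡∑𝟙 (fibre G φ (element t))))) (∣fibre∣≤μ G φ t))
          where
          inFibre-resp : InFibre G φ (element t) Respects _≈_
          inFibre-resp x≈y (x∈G , eq) =
            ∈-resp-≈ G x≈y x∈G , ≈-trans (Func.cong φ (≈-sym x≈y)) eq

          inFibre : ∀ x′ → value x′ ≡ t → x′ ∈ₛ A → x′ ∈ₛ fibre G φ (element t)
          inFibre x′ eq x′∈A = subst (_∈ₛ fibre G φ (element t)) (strictlyInverseˡ x′)
            (∈-⟨⟩⁺ (inFibre? G φ (element t)) inFibre-resp
              (x′∈G , ≈-trans (≈-sym (extend-∈ g x′∈G))
                (≈-trans (≈-sym (strictlyInverseʳ _)) (element-cong eq))))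
            where x′∈G = element∈ (A⊆G x′∈A)

          pointwise : ∀ x′ → 𝟙 (value x′ Fin.≟ t) * 𝟙 (x′ ∈ₛ? A) ≤ 𝟙 (x′ ∈ₛ? fibre G φ (element t))
          pointwise x′ = ℕ.≤-trans
            (𝟙*-monoʳ (value x′ Fin.≟ t) λ eq → 𝟙-mono (x′ ∈ₛ? A) (x′ ∈ₛ? fibre G φ (element t)) (inFibre x′ eq))
            (ℕ.≤-trans (ℕ.*-monoˡ-≤ _ (𝟙≤1 (value x′ Fin.≟ t))) (ℕ.≤-reflexive (ℕ.*-identityˡ _)))

      line-rich : ∀ {A B C} → A ⊆ G → B ⊆ R* → ∀ {x c} → x ∈ₛ A → c ∈ₛ C →
        ∣ B ∣ ≤ ∑[ s < size ] (𝟙 (line x c s ∈ₛ? image G R* (affineTwist g h) A B) * 𝟙 (s ∈ₛ? (B ⊕ C)))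
      line-rich {A} {B} {C} A⊆G B⊆R* {x} {c} x∈A c∈C = begin
        ∣ B ∣
          ≡⟨ ∣∣≡∑𝟙 B ⟩
        ∑[ y < size ] 𝟙 (y ∈ₛ? B)
          ≤⟨ ∑-mono pointwise ⟩
        ∑[ y < size ] onGrid (element y +ᴿ element c)
          ≡⟨ ∑-translate onGrid (λ w≈w′ → cong₂ _*_
               (cong (λ i → 𝟙 (i ∈ₛ? F)) (index-cong (height-cong x c w≈w′)))
               (cong (λ i → 𝟙 (i ∈ₛ? (B ⊕ C))) (index-cong w≈w′))) (element c) ⟩
        ∑[ s < size ] onGrid (element s)
          ≡⟨ sum-cong-≗ (λ s → cong (λ i → 𝟙 (line x c s ∈ₛ? F) * 𝟙 (i ∈ₛ? (B ⊕ C))) (strictlyInverseˡ s)) ⟩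
        ∑[ s < size ] (𝟙 (line x c s ∈ₛ? F) * 𝟙 (s ∈ₛ? (B ⊕ C))) ∎
        where
        open ℕ.≤-Reasoning
        f = affineTwist g h
        F = image G R* f A B

        onGrid : Carrier → ℕ
        onGrid w = 𝟙 (height x c w ∈? F) * 𝟙 (w ∈? (B ⊕ C))

        x∈G : element x ∈ G
        x∈G = element∈ (A⊆G x∈A)

        inImage : ∀ {y} → y ∈ₛ B → height x c (element y +ᴿ element c) ∈ F
        inImage {y} y∈B = ∈-⟨⟩⁺ (inImage? G R* f A B)
          (λ t≈t′ (x , x∈A , y , y∈B , eq) → x , x∈A , y , y∈B , ≈-trans eq t≈t′)
          ((element x , x∈G) , element∈ x∈A , (element y , element∈ (B⊆R* y∈B)) , element∈ y∈B ,
            *-cong (≈-sym (extend-∈ g x∈G))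
              (+-cong (≈-sym (extend-∈ h x∈G)) (≈-sym (//-rightDividesʳ (element c) (element y)))))

        inSumset : ∀ {y} → y ∈ₛ B → (element y +ᴿ element c) ∈ (B ⊕ C)
        inSumset {y} y∈B = ∈-⟨⟩⁺ (inSumset? B C)
          (λ t≈t′ (b , b∈B , c , c∈C , eq) → b , b∈B , c , c∈C , ≈-trans eq t≈t′)
          (element y , element∈ y∈B , element c , element∈ c∈C , ≈-refl)

        pointwise : ∀ y → 𝟙 (y ∈ₛ? B) ≤ onGrid (element y +ᴿ element c)
        pointwise y = ℕ.≤-trans (ℕ.≤-reflexive (sym (𝟙-idem (y ∈ₛ? B))))
          (ℕ.*-mono-≤ (𝟙-mono (y ∈ₛ? B) (_ ∈? F) inImage) (𝟙-mono (y ∈ₛ? B) (_ ∈? (B ⊕ C)) inSumset))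

      image-sumset-bound : ∀ {z r q} → IsUniformizer z → IsNilpotencyDegree z r →
        Inverse (quotient z) (≡.setoid (Fin q)) → ∀ {A B C} → A ⊆ G → B ⊆ R* →
        .{{NonZero (μ G (function g (inclusion R*)))}} → .{{NonZero q}} →
        let P = ∣ image G R* (affineTwist g h) A B ∣ * ∣ B ⊕ C ∣ in
        2 * P ≤ q ^ r * ∣ B ∣ →
        ∣ A ∣ * ∣ C ∣ * (∣ B ∣ * ∣ B ∣) ≤
          4 * P * (q ^ r * (μ G (function g (inclusion R*)) * q ^ (r ∸ 1)))
      image-sumset-bound {z} {r} {q} uniformizer nilpotency residueField {A} {B} {C} A⊆G B⊆R* few =
        subst (λ n → _ ≤ 4 * (∣ F ∣ * ∣ B ⊕ C ∣) * (n * T)) size≡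
          (incidence-bound A C F (B ⊕ C) line {{Fin.nonZeroIndex (index 0#)}}
            (λ x x′ → z ∣? slope x′ -ᴿ slope x) (∣ B ∣) T
            {{ℕ.m*n≢0 m (q ^ (r ∸ 1)) {{it}} {{ℕ.m^n≢0 q (r ∸ 1)}}}}
            (λ {x} {s} → line-parallel {x} {s})
            (λ {x} {x′} {c} {c′} ¬near → line-meet {x} {x′} {c} {c′}
              (∤⇒unit uniformizer {r} (proj₁ nilpotency) ¬near))
            (λ x → ℕ.≤-trans (∑-near A⊆G z x)
              (ℕ.*-monoʳ-≤ m (multiples-uniformizer uniformizer nilpotency residueField)))
            (line-rich A⊆G B⊆R*)
            (subst (λ n → _ ≤ n * ∣ B ∣) (sym size≡) few))
        where
        m = μ G (function g (inclusion R*))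
        F = image G R* (affineTwist g h) A B
        T = m * q ^ (r ∸ 1)
        size≡ : size ≡ q ^ r
        size≡ = size≡q^r uniformizer nilpotency residueField

      image-sumset-dichotomy : ∀ {z r q} → IsUniformizer z → IsNilpotencyDegree z r →
        Inverse (quotient z) (≡.setoid (Fin q)) → ∀ {A B C} → A ⊆ G → B ⊆ R* →
        let m = μ G (function g (inclusion R*))
            P = ∣ image G R* (affineTwist g h) A B ∣ * ∣ B ⊕ C ∣ in
        .{{NonZero m}} → .{{NonZero q}} →
        q ^ r * ∣ B ∣ ≤ 4 * P * m ⊎
        ∣ A ∣ * ∣ B ∣ ^ 2 * ∣ C ∣ ≤ 4 * P * (m ^ 2 * q ^ (2 * r ∸ 1))
      image-sumset-dichotomy {z} {r} {q} uniformizer nilpotency residueField {A} {B} {C} A⊆G B⊆R* =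
        Sum.map many few (ℕ.≤-total (q ^ r * ∣ B ∣) (2 * points))
        where
        m points : ℕ
        m = μ G (function g (inclusion R*))
        points = ∣ image G R* (affineTwist g h) A B ∣ * ∣ B ⊕ C ∣

        many : q ^ r * ∣ B ∣ ≤ 2 * points → q ^ r * ∣ B ∣ ≤ 4 * points * m
        many le = ℕ.≤-trans le
          (ℕ.≤-trans (ℕ.*-monoˡ-≤ points {2} {4} (s≤s (s≤s z≤n))) (ℕ.m≤m*n (4 * points) m))

        exponents : ∀ r → r + (r ∸ 1) ≡ 2 * r ∸ 1
        exponents zero    = refl
        exponents (suc r) = trans (sym (ℕ.+-suc r r)) (cong (λ k → r + suc k) (sym (ℕ.+-identityʳ r)))

        few : 2 * points ≤ q ^ r * ∣ B ∣ →
          ∣ A ∣ * ∣ B ∣ ^ 2 * ∣ C ∣ ≤ 4 * points * (m ^ 2 * q ^ (2 * r ∸ 1))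
        few le = begin
          ∣ A ∣ * ∣ B ∣ ^ 2 * ∣ C ∣
            ≡⟨ rearrange (∣ A ∣) (∣ B ∣) (∣ C ∣) ⟩
          ∣ A ∣ * ∣ C ∣ * (∣ B ∣ * ∣ B ∣)
            ≤⟨ image-sumset-bound uniformizer nilpotency residueField A⊆G B⊆R* le ⟩
          4 * points * (q ^ r * (m * q ^ (r ∸ 1)))
            ≡⟨ cong (4 * points *_) (*-swap (q ^ r) m (q ^ (r ∸ 1))) ⟩
          4 * points * (m * (q ^ r * q ^ (r ∸ 1)))
            ≡⟨ cong (λ e → 4 * points * (m * e))
                 (trans (sym (ℕ.^-distribˡ-+-* q r (r ∸ 1))) (cong (q ^_) (exponents r))) ⟩
          4 * points * (m * q ^ (2 * r ∸ 1))
            ≤⟨ ℕ.*-monoʳ-≤ (4 * points) (ℕ.*-monoˡ-≤ (q ^ (2 * r ∸ 1)) (ℕ.m≤m*n m (m * 1) {{m*n≢0 m 1}})) ⟩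
          4 * points * (m ^ 2 * q ^ (2 * r ∸ 1)) ∎
          where
          open ℕ.≤-Reasoning
          rearrange : ∀ a b c → a * (b * (b * 1)) * c ≡ a * c * (b * b)
          rearrange = solve-∀

¼*/≤ : ∀ x d z .{{_ : NonZero d}} → x ≤ 4 * z * d → (+ 1 / 4) ℚ.* (+ x / d) ℚ.≤ + z / 1
¼*/≤ x (suc d-1) z x≤4zd = ℚ.toℚᵘ-cancel-≤ (begin
  ℚ.toℚᵘ ((+ 1 / 4) ℚ.* (+ x / suc d-1))               ≃⟨ ℚ.toℚᵘ-homo-* (+ 1 / 4) (+ x / suc d-1) ⟩
  ℚ.toℚᵘ (+ 1 / 4) ℚᵘ.* ℚ.toℚᵘ (+ x / suc d-1)         ≃⟨ ℚᵘ.*-congˡ {ℚ.toℚᵘ (+ 1 / 4)} (ℚ.toℚᵘ-fromℚᵘ (mkℚᵘ (+ x) d-1)) ⟩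
  mkℚᵘ (+ 1) 3 ℚᵘ.* mkℚᵘ (+ x) d-1                     ≤⟨ ℚᵘ.*≤* (subst₂ ℤ._≤_ (lhs x) rhs (ℤ.+≤+ x≤4zd)) ⟩
  mkℚᵘ (+ z) 0                                         ≃⟨ ℚ.toℚᵘ-fromℚᵘ (mkℚᵘ (+ z) 0) ⟨
  ℚ.toℚᵘ (+ z / 1)                                     ∎)
  where
  open ℚᵘ.≤-Reasoning
  lhs : ∀ x → + x ≡ + 1 ℤ.* + x ℤ.* + 1
  lhs x = sym (trans (ℤ.*-identityʳ _) (ℤ.*-identityˡ (+ x)))
  rearrange : ∀ z d → 4 * z * d ≡ z * (4 * d)
  rearrange = solve-∀
  rhs : + (4 * z * suc d-1) ≡ + z ℤ.* + (4 * suc d-1)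
  rhs = trans (cong +_ (rearrange z (suc d-1))) (ℤ.pos-* z (4 * suc d-1))

¼*⊓≤ : ∀ x d x′ d′ z .{{_ : NonZero d}} .{{_ : NonZero d′}} →
  x ≤ 4 * z * d ⊎ x′ ≤ 4 * z * d′ → (+ 1 / 4) ℚ.* ((+ x / d) ⊓ (+ x′ / d′)) ℚ.≤ + z / 1
¼*⊓≤ x d x′ d′ z (inj₁ x≤4zd) =
  ℚ.≤-trans (ℚ.*-monoˡ-≤-nonNeg (+ 1 / 4) (ℚ.p⊓q≤p (+ x / d) (+ x′ / d′))) (¼*/≤ x d z x≤4zd)
¼*⊓≤ x d x′ d′ z (inj₂ x′≤4zd′) =
  ℚ.≤-trans (ℚ.*-monoˡ-≤-nonNeg (+ 1 / 4) (ℚ.p⊓q≤q (+ x / d) (+ x′ / d′))) (¼*/≤ x′ d′ z x′≤4zd′)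

theorem1p12 : ∀ {a ℓ} (r : ℕ) → ∃[ c ] 0ℚ ℚ.< c ×
    ((R : FiniteValuationRing a ℓ) →
     let open FiniteValuationRing R hiding (_*_) in
     ∀ z → IsUniformizer z → IsNilpotencyDegree z r →
     ∀ q (residueField : Inverse (quotient z) (≡.setoid (Fin q))) →
     ∀ G (isSubgroup : IsSubgroupOfUnits G) (g h : Func ⟦ G ⟧ ⟦ R* ⟧) →
     let f   = affineTwist g h
         m   = μ G (function g (inclusion R*))
         m≢0 = μ≢0 isSubgroup (function g (inclusion R*))
         q≢0 = quotientSize≢0 residueField
     in
     ∀ (A B C : Subset size) → A ⊆ G → B ⊆ R* → C ⊆ R* →
     c ℚ.* (_/_ (+ (q ^ r * ∣ B ∣)) m {{m≢0}}
            ⊓ _/_ (+ (∣ A ∣ * ∣ B ∣ ^ 2 * ∣ C ∣)) (m ^ 2 * q ^ (2 * r ∸ 1))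
                  {{m*n≢0 (m ^ 2) (q ^ (2 * r ∸ 1)) {{m^n≢0 m 2 {{m≢0}}}} {{m^n≢0 q (2 * r ∸ 1) {{q≢0}}}}}})
       ℚ.≤ + (∣ image G R* f A B ∣ * ∣ B ⊕ C ∣) / 1)
theorem1p12 r = + 1 / 4 , ℚ.positive⁻¹ (+ 1 / 4) ,
  λ R z uniformizer nilpotency q residueField G isSubgroup g h A B C A⊆G B⊆R* _ →
    let open FiniteValuationRing R using (μ; μ≢0; inclusion; R*; quotientSize≢0; image; affineTwist; _⊕_)
        φ = function g (inclusion R*)
        instance
          m≢0 : NonZero (μ G φ)
          m≢0 = μ≢0 isSubgroup φ
          q≢0 : NonZero q
          q≢0 = quotientSize≢0 residueField
    in ¼*⊓≤ (q ^ r * ∣ B ∣) (μ G φ) (∣ A ∣ * ∣ B ∣ ^ 2 * ∣ C ∣) (μ G φ ^ 2 * q ^ (2 * r ∸ 1))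
         (∣ image G R* (affineTwist g h) A B ∣ * ∣ B ⊕ C ∣)
         {{m≢0}} {{m*n≢0 (μ G φ ^ 2) (q ^ (2 * r ∸ 1)) {{m^n≢0 (μ G φ) 2}} {{m^n≢0 q (2 * r ∸ 1)}}}}
         (image-sumset-dichotomy R g h uniformizer nilpotency residueField A⊆G B⊆R*)
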